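{- Let $n,d,r$ be positive integers and let $\pi\in\mathcal{OP}(n,d,r)$. Then the $r$-jellyfish invariant $[\pi]_r$ lies in the flamingo Specht module $S^{(d^r,1^{n-rd})}\subseteq\mathbb{C}[M]$.
   Context: An ordered set partition of $[n]=\{1,\dots,n\}$ with $d$ blocks is a sequence $\pi=(\pi_1\mid\cdots\mid\pi_d)$ of nonempty pairwise disjoint subsets of $[n]$ whose union is $[n]$; $\mathcal{OP}(n,d,r)$ is the set of such with every block of size at least $r$ (so $rd\le n$). Let $M=(x_{ij})_{1\le i,j\le n}$ be an $n\times n$ matrix of distinct indeterminates and $\mathbb{C}[M]$ the polynomial ring in them. For $I,J\subseteq[n]$ with $|I|=|J|$, $M_I^J$ is the determinant of the submatrix of $M$ with rows $I$ and columns $J$, each taken in increasing order. For $\pi\in\mathcal{OP}(n,d,r)$, an $r$-jellyfish tableau for $\pi$ is an array $T$ with $n-(d-1)r$ rows and $d$ columns, each cell empty or containing an element of $[n]$, such that: every cell in rows $1,\dots,r$ is nonempty; each row $i>r$ has exactly one nonempty cell; and the nonempty entries of column $j$ are exactly the elements of $\pi_j$, increasing from top to bottom. Let $\mathcal{J}_r(\pi)$ be the set of these. The sign $\mathrm{sgn}(T)=(-1)^{\mathrm{inv}(T)}$, where $\mathrm{inv}(T)$ is the number of inversions (pairs of entries appearing in decreasing order) of the row reading word of $T$ (entries read left to right within each row, rows from top to bottom, empty cells skipped). Put $\mathrm{J}(T)=\prod_{j=1}^d M^{\pi_j}_{R_j(T)}$, where $R_j(T)$ is the set of indices of rows in which column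 $j$ of $T$ is nonempty. The $r$-jellyfish invariant is $[\pi]_r=\sum_{T\in\mathcal{J}_r(\pi)}\mathrm{sgn}(T)\,\mathrm{J}(T)$. The flamingo Specht module $S^{(d^r,1^{n-rd})}$ is the $\mathbb{C}$-linear span in $\mathbb{C}[M]$ of all products $M^{J_0}_{\{1,\dots,n-rd+r\}}\prod_{i=1}^{d-1}M^{J_i}_{\{1,\dots,r\}}$, where $(J_0,J_1,\dots,J_{d-1})$ ranges over sequences of pairwise disjoint subsets of $[n]$ with union $[n]$, $|J_0|=n-rd+r$ and $|J_i|=r$ for $i\ge1$ (products of top-justified minors); with $\mathfrak{S}_n$ permuting columns of $M$, it is the irreducible representation of $\mathfrak{S}_n$ indexed by the partition $(d^r,1^{n-rd})$. -}

module Defs where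

open import Data.Nat as ℕ using (ℕ; zero; suc; _∸_; _≤_; _<ᵇ_; _≡ᵇ_)
open import Data.Nat.Properties using (m∸n≤m)
open import Data.Fin as Fin using (Fin; toℕ; inject≤)
open import Data.Bool using (Bool; true; false; if_then_else_; _∧_)
open import Data.Maybe using (Maybe; just; nothing; is-just)
open import Data.List using (List; []; _∷_; _++_; [_]; map; concatMap; filter; filterᵇ; allFin; take; length; foldr; catMaybes)
import Data.List.Properties as LP
import Data.Vec as V
open V using (Vec)
import Data.Vec.Properties as VP
open import Data.Rational using (ℚ; 0ℚ; 1ℚ) renaming (_+_ to _+ℚ_; _*_ to _*ℚ_; -_ to -ℚ_)
open import Data.Product using (_×_; _,_; proj₁; proj₂; ∃)
open import Data.List.Relation.Unary.All using (All)
open import Relation.Binary.PropositionalEquality using (_≡_)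
open import Relation.Nullary.Decidable using (yes; no; ⌊_⌋)

-- A monomial: exponent matrix (row i, column j) ↦ exponent of x_ij.
Mono : ℕ → Set
Mono n = Vec (Vec ℕ n) n

-- A polynomial: a formal finite sum of terms c·m (not necessarily normalised).
Poly : ℕ → Set
Poly n = List (ℚ × Mono n)

coeff : ∀ {n} → Poly n → Mono n → ℚ
coeff [] m = 0ℚ
coeff ((c , m′) ∷ p) m with VP.≡-dec (VP.≡-dec ℕ._≟_) m′ m
... | yes _ = c +ℚ coeff p m
... | no  _ = coeff p m

infix 4 _≈P_
_≈P_ : ∀ {n} → Poly n → Poly n → Set
p ≈P q = ∀ m → coeff p m ≡ coeff q m

zeroP : ∀ {n} → Poly n
zeroP = []

oneP : ∀ {n} → Poly n
oneP {n} = [ (1ℚ , V.replicate n (V.replicate n 0)) ]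

var : ∀ {n} → Fin n → Fin n → Poly n
var {n} i j = [ (1ℚ , V.tabulate (λ a → V.tabulate (λ b →
                 if ⌊ a Fin.≟ i ⌋ ∧ ⌊ b Fin.≟ j ⌋ then 1 else 0))) ]

infixl 6 _+P_
infixl 7 _*P_
_+P_ : ∀ {n} → Poly n → Poly n → Poly n
p +P q = p ++ q

_*P_ : ∀ {n} → Poly n → Poly n → Poly n
p *P q = concatMap (λ t → map (λ s → (proj₁ t *ℚ proj₁ s ,
           V.zipWith (V.zipWith ℕ._+_) (proj₂ t) (proj₂ s))) q) p

scale : ∀ {n} → ℚ → Poly n → Poly n
scale c p = map (λ t → (c *ℚ proj₁ t , proj₂ t)) p

sumP : ∀ {n} → List (Poly n) → Poly n
sumP = foldr _+P_ zeroP

prodP : ∀ {n} → List (Poly n) → Poly n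
prodP = foldr _*P_ oneP

sgnQ : ℕ → ℚ
sgnQ zero = 1ℚ
sgnQ (suc k) = -ℚ sgnQ k

-- Minors.  minor I J = M_I^J : determinant of the submatrix with rows I
-- and columns J (lists given in increasing order), by cofactor expansion
-- along the first row.

minor : ∀ {n} → List (Fin n) → List (Fin n) → Poly n
minor [] [] = oneP
minor [] (_ ∷ _) = zeroP
minor (i ∷ is) cs = go 0 [] cs
  where
  go : ℕ → List _ → List _ → Poly _
  go k pre [] = zeroP
  go k pre (c ∷ post) =
    scale (sgnQ k) (var i c *P minor is (pre ++ post)) +P go (suc k) (pre ++ [ c ]) post

-- Ordered set partitions: π_j = { i | block i = j }.

fiber : ∀ {n d} → (Fin n → Fin d) → Fin d → List (Fin n)
fiber {n} f j = filter (λ i → f i Fin.≟ j) (allFin n)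

record OP (n d r : ℕ) : Set where
  field
    block    : Fin n → Fin d
    nonempty : ∀ j → 1 ≤ length (fiber block j)
    large    : ∀ j → r ≤ length (fiber block j)

allVecs : ∀ {A : Set} (k : ℕ) → List A → List (Vec A k)
allVecs zero xs = [ V.[] ]
allVecs (suc k) xs = concatMap (λ x → map (x V.∷_) (allVecs k xs)) xs

cells : (n : ℕ) → List (Maybe (Fin n))
cells n = nothing ∷ map just (allFin n)

nRows : ℕ → ℕ → ℕ → ℕ
nRows n d r = n ∸ (d ∸ 1) ℕ.* r

Array : ℕ → ℕ → ℕ → Set
Array n d r = Vec (Vec (Maybe (Fin n)) d) (nRows n d r)

allᵇ : ∀ {A : Set} → (A → Bool) → List A → Bool
allᵇ p = foldr (λ x b → p x ∧ b) true

countᵇ : ∀ {A : Set} → (A → Bool) → List A → ℕ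
countᵇ p xs = length (filterᵇ p xs)

columnEntries : ∀ {n d r} → Array n d r → Fin d → List (Fin n)
columnEntries T j = catMaybes (V.toList (V.map (λ row → V.lookup row j) T))

isJelly : ∀ {n d r} → OP n d r → Array n d r → Bool
isJelly {n} {d} {r} π T =
  allᵇ (λ ρ → let row = V.toList (V.lookup T ρ) in
             if toℕ ρ <ᵇ r then allᵇ is-just row
                           else countᵇ is-just row ≡ᵇ 1)
      (allFin (nRows n d r))
  ∧ allᵇ (λ j → ⌊ LP.≡-dec Fin._≟_ (columnEntries T j) (fiber (OP.block π) j) ⌋)
        (allFin d)

jellyTableaux : ∀ {n d r} → OP n d r → List (Array n d r)
jellyTableaux {n} {d} {r} π =
  filterᵇ (isJelly π) (allVecs (nRows n d r) (allVecs d (cells n)))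

readingWord : ∀ {n d r} → Array n d r → List (Fin n)
readingWord T = concatMap (λ row → catMaybes (V.toList row)) (V.toList T)

inv : ∀ {n} → List (Fin n) → ℕ
inv [] = 0
inv (x ∷ xs) = countᵇ (λ y → toℕ y <ᵇ toℕ x) xs ℕ.+ inv xs

-- R_j(T), as row indices of M
rowsOf : ∀ {n d r} → Array n d r → Fin d → List (Fin n)
rowsOf {n} {d} {r} T j =
  map (λ ρ → inject≤ ρ (m∸n≤m n ((d ∸ 1) ℕ.* r)))
      (filterᵇ (λ ρ → is-just (V.lookup (V.lookup T ρ) j)) (allFin (nRows n d r)))

JT : ∀ {n d r} → OP n d r → Array n d r → Poly n
JT {d = d} π T = prodP (map (λ j → minor (rowsOf T j) (fiber (OP.block π) j)) (allFin d))

jellyfish : ∀ {n d r} → OP n d r → Poly n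
jellyfish π =
  sumP (map (λ T → scale (sgnQ (inv (readingWord T))) (JT π T)) (jellyTableaux π))

-- The flamingo Specht module S^{(d^r,1^{n-rd})}.
-- A sequence (J_0,…,J_{d-1}) of disjoint subsets with union [n] is encoded
-- by g : Fin n → Fin d with J_i = g⁻¹(i).

shapeSize : (n d r : ℕ) → Fin d → ℕ
shapeSize n d r i = if toℕ i ≡ᵇ 0 then n ∸ r ℕ.* d ℕ.+ r else r

Shape : (n d r : ℕ) → (Fin n → Fin d) → Set
Shape n d r g = ∀ i → length (fiber g i) ≡ shapeSize n d r i

flamingoGen : (n d r : ℕ) → (Fin n → Fin d) → Poly n
flamingoGen n d r g =
  prodP (map (λ i → minor (take (shapeSize n d r i) (allFin n)) (fiber g i)) (allFin d))

InFlamingo : (n d r : ℕ) → Poly n → Set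
InFlamingo n d r p =
  ∃ λ (L : List (ℚ × (Fin n → Fin d))) →
    All (λ cg → Shape n d r (proj₂ cg)) L ×
    (p ≈P sumP (map (λ cg → scale (proj₁ cg) (flamingoGen n d r (proj₂ cg))) L))

{-# OPTIONS --safe #-}
module Submission where

-- Let x_i be the i-th row of M and x_i^k its restriction to the columns in the k-th block of π. The jellyfish
-- invariant is the n × n determinant Δ whose rows are, in reading order, x_i^1, …, x_i^d for each i ≤ r and then the
-- full rows x_i for r < i ≤ n - (d-1)r. Indeed, writing each full row as the sum of its restrictions expands Δ into a
-- sum over tableau shapes of determinants that are block diagonal up to a permutation of rows and columns, and the
-- sign of that permutation is the sign of the tableau.
-- Since x_i is the sum of the x_i^k, replacing the row x_i^1 by x_i for each i ≤ r does not change Δ. Now all of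
-- x_1, …, x_{n-(d-1)r} occur, together with x_1^k, …, x_r^k for each k > 1, and the Laplace expansion along these d
-- groups of rows writes Δ as a signed sum of products of top-justified minors.
-- Both expansions rest on the same identity: if each row is supported on the columns of its own colour, then the
-- determinant is, up to the signs of the colour sequences of the rows and of the columns, the product of its blocks.

open import Defs
open import Algebra.Bundles using (CommutativeMonoid; CommutativeRing)
import Algebra.Properties.CommutativeSemigroup as CSP
import Algebra.Properties.Ring as RingP
import Algebra.Solver.CommutativeMonoid as CMSolver
open import Data.Bool using (Bool; true; false; if_then_else_; _∧_; T)
open import Data.Fin as Fin using (Fin; toℕ; inject≤; zero; suc)
import Data.Fin.Properties as FinP
open import Data.List using (List; []; _∷_; _++_; [_]; map; concatMap; filter; filterᵇ; allFin; tabulate; take; foldr; length; catMaybes)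
open import Data.List.Membership.Propositional using (_∈_)
open import Data.List.Membership.Propositional.Properties using (∈-∃++; ∈-allFin; ∈-filter⁺)
import Data.List.Properties as LP
open import Data.List.Relation.Unary.All as All using (All; []; _∷_)
import Data.List.Relation.Unary.All.Properties as AllP
open import Data.List.Relation.Unary.AllPairs using (AllPairs; []; _∷_)
import Data.List.Relation.Unary.AllPairs.Properties as AllPairsP
open import Data.List.Relation.Unary.Any as Any using (Any; here; there)
import Data.List.Relation.Unary.Any.Properties as AnyP
open import Data.Maybe using (Maybe; just; nothing; is-just)
open import Data.Nat as ℕ using (ℕ; _∸_; _≤_; _<_; _<ᵇ_; z≤n; s≤s)
import Data.Nat.Properties as ℕP
open import Data.Nat.Tactic.RingSolver using (solve-∀)
open import Data.Product using (_×_; _,_; proj₁; proj₂; ∃; ∃₂)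
open import Data.Rational using (ℚ; 0ℚ; 1ℚ) renaming (_+_ to _+ℚ_; _*_ to _*ℚ_; -_ to -ℚ_)
import Data.Rational.Properties as ℚP
open import Data.Sum using (_⊎_; inj₁; inj₂)
open import Data.Unit using (tt)
import Data.Vec as V
open V using (Vec)
import Data.Vec.Properties as VP
open import Function using (_∘_; _∋_; id)
open import Level using (0ℓ)
open import Relation.Binary using (DecidableEquality)
open import Relation.Binary.PropositionalEquality as ≡ using (_≡_; _≢_)
open import Relation.Nullary using (Dec; yes; no; contradiction; ¬_)
open import Relation.Nullary.Decidable using (⌊_⌋; _×-dec_; _⊎-dec_)

-- No permutation occurs: `det` takes a list of rows and a list of columns and expands along the
-- first row. The obstacle is the sign. The sign of a tableau counts inversions among its entries,
-- while the colour identity yields inversions of two sequences of colours. They agree because, for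
-- a given shape, at most one filling reads every block in increasing order, and deleting its first
-- letter changes the sign just as deleting a first row does; `sgn-peel` serves both. The two
-- expansions colour the columns differently: by `π` in the sum over shapes, by an arbitrary
-- function `Fin n → Fin D` in the Laplace expansion. Inadmissible terms need not be excluded in
-- advance: wrong class sizes produce a block that is not square, and a column placed among rows
-- restricted to another block of `π` is a zero column. In both cases the term vanishes.

-- Polynomials as a commutative ring

module _ {n : ℕ} where

  infixl 7 _·_
  _·_ : Mono n → Mono n → Mono n
  _·_ = V.zipWith (V.zipWith ℕ._+_)

  -- Truncated subtraction of exponents. It inverts multiplication by a monomial and decides
  -- divisibility: `a` divides `m` exactly when `a · (m ÷ a)` is `m`.
  _÷_ : Mono n → Mono n → Mono n
  _÷_ = V.zipWith (V.zipWith ℕ._∸_)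

  _≟M_ : DecidableEquality (Mono n)
  _≟M_ = VP.≡-dec (VP.≡-dec ℕ._≟_)

  ·-assoc : ∀ a b c → (a · b) · c ≡ a · (b · c)
  ·-assoc = VP.zipWith-assoc (VP.zipWith-assoc ℕP.+-assoc)

  ·-comm : ∀ a b → a · b ≡ b · a
  ·-comm = VP.zipWith-comm (VP.zipWith-comm ℕP.+-comm)

  ·-identityˡ : ∀ a → V.replicate n (V.replicate n 0) · a ≡ a
  ·-identityˡ = VP.zipWith-identityˡ (VP.zipWith-identityˡ ℕP.+-identityˡ)

  ·-÷ : ∀ a b → (a · b) ÷ a ≡ b
  ·-÷ = zipWith-retract (V.zipWith ℕ._+_) (V.zipWith ℕ._∸_)
          (zipWith-retract ℕ._+_ ℕ._∸_ ℕP.m+n∸m≡n)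
    where
    zipWith-retract : ∀ {A : Set} {k} (f g : A → A → A) → (∀ a b → g (f a b) a ≡ b) →
      (as bs : V.Vec A k) → V.zipWith g (V.zipWith f as bs) as ≡ bs
    zipWith-retract f g h V.[] V.[] = ≡.refl
    zipWith-retract f g h (a V.∷ as) (b V.∷ bs) = ≡.cong₂ V._∷_ (h a b) (zipWith-retract f g h as bs)

  ·-cancelˡ : ∀ a {b c} → a · b ≡ a · c → b ≡ c
  ·-cancelˡ a {b} {c} e = ≡.trans (≡.sym (·-÷ a b)) (≡.trans (≡.cong (_÷ a) e) (·-÷ a c))

  coeff-yes : ∀ c {m m′} (p : Poly n) → m′ ≡ m → coeff ((c , m′) ∷ p) m ≡ c +ℚ coeff p m
  coeff-yes c {m} {m′} p e with m′ ≟M m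
  ... | yes _ = ≡.refl
  ... | no ¬e = contradiction e ¬e

  coeff-no : ∀ c {m m′} (p : Poly n) → m′ ≢ m → coeff ((c , m′) ∷ p) m ≡ coeff p m
  coeff-no c {m} {m′} p ¬e with m′ ≟M m
  ... | yes e = contradiction e ¬e
  ... | no _  = ≡.refl

  coeff-++ : ∀ (p q : Poly n) m → coeff (p ++ q) m ≡ coeff p m +ℚ coeff q m
  coeff-++ [] q m = ≡.sym (ℚP.+-identityˡ _)
  coeff-++ ((c , m′) ∷ p) q m with m′ ≟M m
  ... | yes _ = ≡.trans (≡.cong (c +ℚ_) (coeff-++ p q m)) (≡.sym (ℚP.+-assoc c _ _))
  ... | no _  = coeff-++ p q m

  coeff-scale : ∀ c (p : Poly n) m → coeff (scale c p) m ≡ c *ℚ coeff p m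
  coeff-scale c [] m = ≡.sym (ℚP.*-zeroʳ c)
  coeff-scale c ((b , m′) ∷ p) m with m′ ≟M m
  ... | yes _ = ≡.trans (≡.cong (c *ℚ b +ℚ_) (coeff-scale c p m)) (≡.sym (ℚP.*-distribˡ-+ c b _))
  ... | no _  = coeff-scale c p m

  term* : ℚ × Mono n → Poly n → Poly n
  term* t = map (λ s → proj₁ t *ℚ proj₁ s , proj₂ t · proj₂ s)

  coeff-term* : ∀ c a (p : Poly n) m → coeff (term* (c , a) p) (a · m) ≡ c *ℚ coeff p m
  coeff-term* c a [] m = ≡.sym (ℚP.*-zeroʳ c)
  coeff-term* c a ((b , m′) ∷ p) m with m′ ≟M m
  ... | yes e = ≡.trans (coeff-yes (c *ℚ b) (term* (c , a) p) (≡.cong (a ·_) e))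
                  (≡.trans (≡.cong (c *ℚ b +ℚ_) (coeff-term* c a p m)) (≡.sym (ℚP.*-distribˡ-+ c b _)))
  ... | no ¬e = ≡.trans (coeff-no (c *ℚ b) (term* (c , a) p) (λ e → ¬e (·-cancelˡ a e)))
                  (coeff-term* c a p m)

  coeff-term*-∤ : ∀ c a (p : Poly n) m → (∀ m′ → a · m′ ≢ m) → coeff (term* (c , a) p) m ≡ 0ℚ
  coeff-term*-∤ c a [] m ∤ = ≡.refl
  coeff-term*-∤ c a ((b , m′) ∷ p) m ∤ =
    ≡.trans (coeff-no (c *ℚ b) (term* (c , a) p) (∤ m′)) (coeff-term*-∤ c a p m ∤)

  -- A record rather than _≈P_ itself, so that both polynomials can be inferred from the type of an equality proof.
  infix 4 _≃_
  record _≃_ (p q : Poly n) : Set where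
    constructor coeffwise
    field coeffs : p ≈P q
  open _≃_ public

  ≡⇒≃ : {p q : Poly n} → p ≡ q → p ≃ q
  ≡⇒≃ ≡.refl = coeffwise λ _ → ≡.refl

  ≃-trans : {p q r : Poly n} → p ≃ q → q ≃ r → p ≃ r
  ≃-trans (coeffwise e) (coeffwise f) = coeffwise λ m → ≡.trans (e m) (f m)

  ≃-sym : {p q : Poly n} → p ≃ q → q ≃ p
  ≃-sym (coeffwise e) = coeffwise λ m → ≡.sym (e m)

  ++-cong : {p p′ q q′ : Poly n} → p ≃ p′ → q ≃ q′ → p +P q ≃ p′ +P q′
  ++-cong {p} {p′} {q} {q′} (coeffwise e) (coeffwise f) = coeffwise λ m →
    ≡.trans (coeff-++ p q m) (≡.trans (≡.cong₂ _+ℚ_ (e m) (f m)) (≡.sym (coeff-++ p′ q′ m)))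

  ++-comm : ∀ (p q : Poly n) → p +P q ≃ q +P p
  ++-comm p q = coeffwise λ m →
    ≡.trans (coeff-++ p q m) (≡.trans (ℚP.+-comm (coeff p m) (coeff q m)) (≡.sym (coeff-++ q p m)))

  scale-cong : ∀ c {p q : Poly n} → p ≃ q → scale c p ≃ scale c q
  scale-cong c {p} {q} (coeffwise e) = coeffwise λ m →
    ≡.trans (coeff-scale c p m) (≡.trans (≡.cong (c *ℚ_) (e m)) (≡.sym (coeff-scale c q m)))

  negP : Poly n → Poly n
  negP = scale (-ℚ 1ℚ)

  coeff-neg : ∀ p m → coeff (negP p) m ≡ -ℚ coeff p m
  coeff-neg p m = ≡.trans (coeff-scale (-ℚ 1ℚ) p m)
    (≡.trans (≡.sym (ℚP.neg-distribˡ-* 1ℚ (coeff p m))) (≡.cong -ℚ_ (ℚP.*-identityˡ _)))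

  neg-inverseʳ : ∀ p → p +P negP p ≃ zeroP
  neg-inverseʳ p = coeffwise λ m → ≡.trans (coeff-++ p (negP p) m)
    (≡.trans (≡.cong (coeff p m +ℚ_) (coeff-neg p m)) (ℚP.+-inverseʳ (coeff p m)))

  -- Equal coefficients do not give equal lists of terms, so the argument goes through coefficients:
  -- that of `m` in a multiple of the monomial `a` is `c` times one coefficient of the other factor
  -- if `a` divides `m`, and zero otherwise.
  term*-cong : ∀ t {p q : Poly n} → p ≃ q → term* t p ≃ term* t q
  term*-cong (c , a) {p} {q} (coeffwise e) = coeffwise eq
    where
    eq : term* (c , a) p ≈P term* (c , a) q
    eq m with (a · (m ÷ a)) ≟M m
    ... | yes d = ≡.subst (λ m → coeff (term* (c , a) p) m ≡ coeff (term* (c , a) q) m) d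
                    (≡.trans (coeff-term* c a p _) (≡.trans (≡.cong (c *ℚ_) (e _)) (≡.sym (coeff-term* c a q _))))
    ... | no ¬d = ≡.trans (coeff-term*-∤ c a p m ∤) (≡.sym (coeff-term*-∤ c a q m ∤))
      where
      ∤ : ∀ m′ → a · m′ ≢ m
      ∤ m′ ≡.refl = ¬d (≡.cong (a ·_) (·-÷ a m′))

  *P-congˡ : ∀ p {q q′ : Poly n} → q ≃ q′ → p *P q ≃ p *P q′
  *P-congˡ [] e = coeffwise λ _ → ≡.refl
  *P-congˡ (t ∷ p) e = ++-cong (term*-cong t e) (*P-congˡ p e)

  *P-zeroʳ : ∀ (p : Poly n) → p *P [] ≡ []
  *P-zeroʳ [] = ≡.refl
  *P-zeroʳ (t ∷ p) = *P-zeroʳ p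

  ++-swap : ∀ (p q r : Poly n) → p +P (q +P r) ≃ q +P (p +P r)
  ++-swap p q r = ≃-trans (≡⇒≃ (≡.sym (LP.++-assoc p q r)))
    (≃-trans (++-cong (++-comm p q) (≡⇒≃ ≡.refl)) (≡⇒≃ (LP.++-assoc q p r)))

  *P-∷ʳ : ∀ (p : Poly n) t q → p *P (t ∷ q) ≃ term* t p +P p *P q
  *P-∷ʳ [] t q = ≡⇒≃ ≡.refl
  *P-∷ʳ (s ∷ p) t q = ++-cong {[ _ ]} {[ _ ]}
    (≡⇒≃ (≡.cong [_] (≡.cong₂ _,_ (ℚP.*-comm (proj₁ s) (proj₁ t)) (·-comm (proj₂ s) (proj₂ t)))))
    (≃-trans (++-cong {p = term* s q} (≡⇒≃ ≡.refl) (*P-∷ʳ p t q))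
      (++-swap (term* s q) (term* t p) (p *P q)))

  *P-comm : ∀ (p q : Poly n) → p *P q ≃ q *P p
  *P-comm [] q = ≡⇒≃ (≡.sym (*P-zeroʳ q))
  *P-comm (t ∷ p) q = ≃-trans (++-cong {p = term* t q} (≡⇒≃ ≡.refl) (*P-comm p q)) (≃-sym (*P-∷ʳ q t p))

  *P-cong : {p p′ q q′ : Poly n} → p ≃ p′ → q ≃ q′ → p *P q ≃ p′ *P q′
  *P-cong {p} {p′} {q} {q′} e f = ≃-trans (*P-congˡ p f)
    (≃-trans (*P-comm p q′) (≃-trans (*P-congˡ q′ e) (*P-comm q′ p′)))

  *P-distribʳ : ∀ (r p q : Poly n) → (p +P q) *P r ≡ p *P r +P q *P r
  *P-distribʳ r p q = LP.concatMap-++ _ p q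

  *P-distribˡ : ∀ (r p q : Poly n) → r *P (p +P q) ≃ r *P p +P r *P q
  *P-distribˡ r p q = ≃-trans (*P-comm r (p +P q)) (≃-trans (≡⇒≃ (*P-distribʳ r p q))
    (++-cong (*P-comm p r) (*P-comm q r)))

  term*-*P : ∀ t (p q : Poly n) → term* t p *P q ≡ term* t (p *P q)
  term*-*P t [] q = ≡.refl
  term*-*P t (s ∷ p) q = ≡.trans (≡.cong₂ _++_ head (term*-*P t p q)) (≡.sym (LP.map-++ _ (term* s q) (p *P q)))
    where
    head : term* (proj₁ t *ℚ proj₁ s , proj₂ t · proj₂ s) q ≡ term* t (term* s q)
    head = ≡.trans (LP.map-cong (λ u → ≡.cong₂ _,_ (ℚP.*-assoc (proj₁ t) _ _) (·-assoc (proj₂ t) _ _)) q)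
             (LP.map-∘ q)

  *P-assoc : ∀ (p q r : Poly n) → (p *P q) *P r ≡ p *P (q *P r)
  *P-assoc [] q r = ≡.refl
  *P-assoc (t ∷ p) q r = ≡.trans (*P-distribʳ r (term* t q) (p *P q))
    (≡.cong₂ _++_ (term*-*P t q r) (*P-assoc p q r))

  *P-identityˡ : ∀ (p : Poly n) → oneP *P p ≡ p
  *P-identityˡ p = ≡.trans (LP.++-identityʳ _)
    (≡.trans (LP.map-cong (λ t → ≡.cong₂ _,_ (ℚP.*-identityˡ (proj₁ t)) (·-identityˡ (proj₂ t))) p) (LP.map-id p))

  scale-*P : ∀ c (p q : Poly n) → scale c p *P q ≡ scale c (p *P q)
  scale-*P c [] q = ≡.refl
  scale-*P c (t ∷ p) q = ≡.trans (≡.cong₂ _++_ head (scale-*P c p q)) (≡.sym (LP.map-++ _ (term* t q) (p *P q)))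
    where
    head : term* (c *ℚ proj₁ t , proj₂ t) q ≡ scale c (term* t q)
    head = ≡.trans (LP.map-cong (λ u → ≡.cong₂ _,_ (ℚP.*-assoc c _ _) ≡.refl) q) (LP.map-∘ q)

polyRing : ℕ → CommutativeRing 0ℓ 0ℓ
polyRing n = record
  { Carrier = Poly n ; _≈_ = _≃_ ; _+_ = _+P_ ; _*_ = _*P_ ; -_ = negP ; 0# = zeroP ; 1# = oneP
  ; isCommutativeRing = record
    { isRing = record
      { +-isAbelianGroup = record
        { isGroup = record
          { isMonoid = record
            { isSemigroup = record
              { isMagma = record
                { isEquivalence = record { refl = ≡⇒≃ ≡.refl ; sym = ≃-sym ; trans = ≃-trans }
                ; ∙-cong = ++-cong }
              ; assoc = λ p q r → ≡⇒≃ (LP.++-assoc p q r) }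
            ; identity = (λ p → ≡⇒≃ ≡.refl) , (λ p → ≡⇒≃ (LP.++-identityʳ p)) }
          ; inverse = (λ p → ≃-trans (++-comm (negP p) p) (neg-inverseʳ p)) , neg-inverseʳ
          ; ⁻¹-cong = scale-cong (-ℚ 1ℚ) }
        ; comm = ++-comm }
      ; *-cong = *P-cong
      ; *-assoc = λ p q r → ≡⇒≃ (*P-assoc p q r)
      ; *-identity = (λ p → ≡⇒≃ (*P-identityˡ p))
                   , (λ p → ≃-trans (*P-comm p oneP) (≡⇒≃ (*P-identityˡ p)))
      ; distrib = *P-distribˡ , (λ r p q → ≡⇒≃ (*P-distribʳ r p q)) }
    ; *-comm = *P-comm } }

-- Folds over `Fin d`, for sums of numbers and for sums and products in a ring

module FinFold {a ℓ} (M : CommutativeMonoid a ℓ) where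
  open CommutativeMonoid M
  open import Relation.Binary.Reasoning.Setoid setoid

  -- A `foldr` over `allFin`, so that in the polynomial ring it unfolds to the products
  -- `prodP (map F (allFin d))` of the statement; `fold-suc` then has to be proved.
  fold : ∀ {d} → (Fin d → Carrier) → Carrier
  fold F = foldr _∙_ ε (map F (allFin _))

  fold-suc : ∀ {d} (F : Fin (ℕ.suc d) → Carrier) → fold F ≡ F zero ∙ fold (F ∘ suc)
  fold-suc F = ≡.cong (λ xs → F zero ∙ foldr _∙_ ε xs)
    (≡.trans (LP.map-tabulate suc F) (≡.sym (LP.map-tabulate id (F ∘ suc))))

  fold-cong : ∀ {d} {F G : Fin d → Carrier} → (∀ j → F j ≈ G j) → fold F ≈ fold G
  fold-cong {ℕ.zero} e = refl
  fold-cong {ℕ.suc d} {F} {G} e = begin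
    fold F                  ≡⟨ fold-suc F ⟩
    F zero ∙ fold (F ∘ suc) ≈⟨ ∙-cong (e zero) (fold-cong (e ∘ suc)) ⟩
    G zero ∙ fold (G ∘ suc) ≡⟨ fold-suc G ⟨
    fold G                  ∎

  fold-ε : ∀ {d} → fold {d} (λ _ → ε) ≈ ε
  fold-ε {ℕ.zero} = refl
  fold-ε {ℕ.suc d} = begin
    fold {ℕ.suc d} (λ _ → ε) ≡⟨ fold-suc {d} (λ _ → ε) ⟩
    ε ∙ fold {d} (λ _ → ε)   ≈⟨ identityˡ _ ⟩
    fold {d} (λ _ → ε)       ≈⟨ fold-ε {d} ⟩
    ε                        ∎

  fold-update : ∀ {d} {F G : Fin d → Carrier} k {x} → F k ≈ x ∙ G k →
    (∀ j → j ≢ k → F j ≈ G j) → fold F ≈ x ∙ fold G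
  fold-update {F = F} {G} zero {x} e e′ = begin
    fold F                        ≡⟨ fold-suc F ⟩
    F zero ∙ fold (F ∘ suc)       ≈⟨ ∙-cong e (fold-cong λ j → e′ (suc j) λ ()) ⟩
    (x ∙ G zero) ∙ fold (G ∘ suc) ≈⟨ assoc x _ _ ⟩
    x ∙ (G zero ∙ fold (G ∘ suc)) ≡⟨ ≡.cong (x ∙_) (fold-suc G) ⟨
    x ∙ fold G                    ∎
  fold-update {F = F} {G} (suc k) {x} e e′ = begin
    fold F                        ≡⟨ fold-suc F ⟩
    F zero ∙ fold (F ∘ suc)       ≈⟨ ∙-cong (e′ zero λ ()) (fold-update k e λ j j≢k → e′ (suc j) (j≢k ∘ FinP.suc-injective)) ⟩
    G zero ∙ (x ∙ fold (G ∘ suc)) ≈⟨ assoc (G zero) x _ ⟨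
    (G zero ∙ x) ∙ fold (G ∘ suc) ≈⟨ ∙-congʳ (comm (G zero) x) ⟩
    (x ∙ G zero) ∙ fold (G ∘ suc) ≈⟨ assoc x _ _ ⟩
    x ∙ (G zero ∙ fold (G ∘ suc)) ≡⟨ ≡.cong (x ∙_) (fold-suc G) ⟨
    x ∙ fold G                    ∎

  -- The factor at `k` becomes the unit instead of leaving the index set, so that the index type
  -- remains `Fin d`.
  except : ∀ {d} → Fin d → (Fin d → Carrier) → Fin d → Carrier
  except k F j = if ⌊ j Fin.≟ k ⌋ then ε else F j

  except-cong : ∀ {d} k {F G : Fin d → Carrier} → (∀ j → j ≢ k → F j ≈ G j) → ∀ j → except k F j ≈ except k G j
  except-cong k e j with j Fin.≟ k
  ... | yes _ = refl
  ... | no j≢k = e j j≢k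

  fold-except : ∀ {d} (F : Fin d → Carrier) k → fold F ≈ F k ∙ fold (except k F)
  fold-except F k = fold-update k at-k off-k
    where
    at-k : F k ≈ F k ∙ except k F k
    at-k with k Fin.≟ k
    ... | yes _ = sym (identityʳ _)
    ... | no k≢k = contradiction ≡.refl k≢k
    off-k : ∀ j → j ≢ k → F j ≈ except k F j
    off-k j j≢k with j Fin.≟ k
    ... | yes j≡k = contradiction j≡k j≢k
    ... | no _ = refl

  fold-indicator : ∀ {d} (k : Fin d) (F : Fin d → Carrier) → fold (λ j → if ⌊ k Fin.≟ j ⌋ then F j else ε) ≈ F k
  fold-indicator {d} k F = trans (fold-update k at-k off-k) (trans (∙-congˡ (fold-ε {d})) (identityʳ _))
    where
    at-k : (if ⌊ k Fin.≟ k ⌋ then F k else ε) ≈ F k ∙ ε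
    at-k with k Fin.≟ k
    ... | yes _ = sym (identityʳ _)
    ... | no k≢k = contradiction ≡.refl k≢k
    off-k : ∀ j → j ≢ k → (if ⌊ k Fin.≟ j ⌋ then F j else ε) ≈ ε
    off-k j j≢k with k Fin.≟ j
    ... | yes k≡j = contradiction (≡.sym k≡j) j≢k
    ... | no _ = refl

-- Counting and inversions

module _ {a} {A : Set a} where

  ofColour : ∀ {d} → (A → Fin d) → Fin d → List A → List A
  ofColour f j = filter (λ c → f c Fin.≟ j)

  ofColour-≡ : ∀ {d} (f : A → Fin d) {j} x xs → f x ≡ j → ofColour f j (x ∷ xs) ≡ x ∷ ofColour f j xs
  ofColour-≡ f {j} x xs = LP.filter-accept (λ c → f c Fin.≟ j)

  ofColour-≢ : ∀ {d} (f : A → Fin d) {j} x xs → f x ≢ j → ofColour f j (x ∷ xs) ≡ ofColour f j xs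
  ofColour-≢ f {j} x xs = LP.filter-reject (λ c → f c Fin.≟ j)

module _ {A : Set} (p : A → Bool) where

  indicator : A → ℕ
  indicator x = if p x then 1 else 0

  countᵇ-∷ : ∀ x xs → countᵇ p (x ∷ xs) ≡ indicator x ℕ.+ countᵇ p xs
  countᵇ-∷ x xs with p x
  ... | true  = ≡.refl
  ... | false = ≡.refl

  countᵇ-++ : ∀ xs ys → countᵇ p (xs ++ ys) ≡ countᵇ p xs ℕ.+ countᵇ p ys
  countᵇ-++ [] ys = ≡.refl
  countᵇ-++ (x ∷ xs) ys = begin
    countᵇ p (x ∷ xs ++ ys)                           ≡⟨ countᵇ-∷ x (xs ++ ys) ⟩
    indicator x ℕ.+ countᵇ p (xs ++ ys)               ≡⟨ ≡.cong (indicator x ℕ.+_) (countᵇ-++ xs ys) ⟩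
    indicator x ℕ.+ (countᵇ p xs ℕ.+ countᵇ p ys)     ≡⟨ ℕP.+-assoc (indicator x) _ _ ⟨
    indicator x ℕ.+ countᵇ p xs ℕ.+ countᵇ p ys       ≡⟨ ≡.cong (ℕ._+ countᵇ p ys) (countᵇ-∷ x xs) ⟨
    countᵇ p (x ∷ xs) ℕ.+ countᵇ p ys                 ∎
    where open ≡.≡-Reasoning

  countᵇ-insert : ∀ xs z ys → countᵇ p (xs ++ z ∷ ys) ≡ indicator z ℕ.+ countᵇ p (xs ++ ys)
  countᵇ-insert xs z ys rewrite countᵇ-++ xs (z ∷ ys) | countᵇ-++ xs ys | countᵇ-∷ z ys =
    lemma (countᵇ p xs) (indicator z) (countᵇ p ys)
    where
    lemma : ∀ a b c → a ℕ.+ (b ℕ.+ c) ≡ b ℕ.+ (a ℕ.+ c)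
    lemma = solve-∀

countᵇ-map : ∀ {A B : Set} (p : B → Bool) (h : A → B) xs → countᵇ p (map h xs) ≡ countᵇ (p ∘ h) xs
countᵇ-map p h [] = ≡.refl
countᵇ-map p h (x ∷ xs) with p (h x)
... | true  = ≡.cong ℕ.suc (countᵇ-map p h xs)
... | false = countᵇ-map p h xs

open FinFold ℕP.+-0-commutativeMonoid using () renaming (fold to ∑ℕ; fold-cong to ∑ℕ-cong; fold-update to ∑ℕ-update; fold-ε to ∑ℕ-0; fold-suc to ∑ℕ-suc)

countᵇ-by-colour : ∀ {A : Set} {d} (f : A → Fin d) (p : A → Bool) xs →
  countᵇ p xs ≡ ∑ℕ (λ j → countᵇ p (ofColour f j xs))
countᵇ-by-colour {d = d} f p [] = ≡.sym (∑ℕ-0 {d})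
countᵇ-by-colour f p (x ∷ xs) = ≡.trans (countᵇ-∷ p x xs)
  (≡.trans (≡.cong (indicator p x ℕ.+_) (countᵇ-by-colour f p xs))
    (≡.sym (∑ℕ-update (f x)
      (≡.trans (≡.cong (countᵇ p) (ofColour-≡ f x xs ≡.refl)) (countᵇ-∷ p x (ofColour f (f x) xs)))
      (λ j j≢ → ≡.cong (countᵇ p) (ofColour-≢ f x xs (j≢ ∘ ≡.sym))))))

countᵇ-colour-class : ∀ {A : Set} {d} (f : A → Fin d) (q : Fin d → Bool) j xs →
  countᵇ (q ∘ f) (ofColour f j xs) ≡ (if q j then length (ofColour f j xs) else 0)
countᵇ-colour-class f q j [] with q j
... | true = ≡.refl
... | false = ≡.refl
countᵇ-colour-class f q j (x ∷ xs) with f x Fin.≟ j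
... | no _ = countᵇ-colour-class f q j xs
... | yes ≡.refl = ≡.trans (countᵇ-∷ (q ∘ f) x _) (≡.trans (≡.cong (indicator (q ∘ f) x ℕ.+_) (countᵇ-colour-class f q j xs)) lemma)
  where
  lemma : indicator (q ∘ f) x ℕ.+ (if q (f x) then length (ofColour f (f x) xs) else 0)
        ≡ (if q (f x) then ℕ.suc (length (ofColour f (f x) xs)) else 0)
  lemma with q (f x)
  ... | true = ≡.refl
  ... | false = ≡.refl

SameColours : ∀ {A B : Set} {d} → (A → Fin d) → List A → (B → Fin d) → List B → Set
SameColours κ σ f cs = ∀ j → length (ofColour κ j σ) ≡ length (ofColour f j cs)

-- A predicate of the colour is constant on each colour class, so the sizes of the classes determine
-- the count.
countᵇ-sameColours : ∀ {A B : Set} {d} {κ : A → Fin d} {σ} {f : B → Fin d} {cs} → SameColours κ σ f cs →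
  ∀ q → countᵇ q (map κ σ) ≡ countᵇ q (map f cs)
countᵇ-sameColours {κ = κ} {σ} {f} {cs} same q = begin
  countᵇ q (map κ σ)                                             ≡⟨ countᵇ-map q κ σ ⟩
  countᵇ (q ∘ κ) σ                                               ≡⟨ countᵇ-by-colour κ (q ∘ κ) σ ⟩
  ∑ℕ (λ j → countᵇ (q ∘ κ) (ofColour κ j σ))                     ≡⟨ ∑ℕ-cong (λ j → countᵇ-colour-class κ q j σ) ⟩
  ∑ℕ (λ j → if q j then length (ofColour κ j σ) else 0)          ≡⟨ ∑ℕ-cong (λ j → ≡.cong (λ l → if q j then l else 0) (same j)) ⟩
  ∑ℕ (λ j → if q j then length (ofColour f j cs) else 0)         ≡⟨ ∑ℕ-cong (λ j → countᵇ-colour-class f q j cs) ⟨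
  ∑ℕ (λ j → countᵇ (q ∘ f) (ofColour f j cs))                    ≡⟨ countᵇ-by-colour f (q ∘ f) cs ⟨
  countᵇ (q ∘ f) cs                                              ≡⟨ countᵇ-map q f cs ⟨
  countᵇ q (map f cs)                                            ∎
  where open ≡.≡-Reasoning

below above : ∀ {d} → Fin d → Fin d → Bool
below k y = toℕ y <ᵇ toℕ k
above k y = toℕ k <ᵇ toℕ y

inv-insert : ∀ {d} (P : List (Fin d)) k Q →
  inv (P ++ k ∷ Q) ≡ inv (P ++ Q) ℕ.+ (countᵇ (above k) P ℕ.+ countᵇ (below k) Q)
inv-insert [] k Q = ℕP.+-comm (countᵇ (below k) Q) (inv Q)
inv-insert (p ∷ P) k Q rewrite countᵇ-insert (below p) P k Q | inv-insert P k Q | countᵇ-∷ (above k) p P =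
  lemma (indicator (below p) k) (countᵇ (below p) (P ++ Q)) (inv (P ++ Q)) (countᵇ (above k) P) (countᵇ (below k) Q)
  where
  lemma : ∀ a b c e f → a ℕ.+ b ℕ.+ (c ℕ.+ (e ℕ.+ f)) ≡ b ℕ.+ c ℕ.+ (a ℕ.+ e ℕ.+ f)
  lemma = solve-∀

trichotomy₁ : ∀ {d} (p k : Fin d) → 1 ≡ indicator (below k) p ℕ.+ length (ofColour id k [ p ]) ℕ.+ indicator (above k) p
trichotomy₁ zero zero = ≡.refl
trichotomy₁ zero (suc k) = ≡.refl
trichotomy₁ (suc p) zero = ≡.refl
trichotomy₁ (suc p) (suc k) with p Fin.≟ k | trichotomy₁ p k
... | yes _ | e = e
... | no _  | e = e

trichotomy : ∀ {d} (P : List (Fin d)) k →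
  length P ≡ countᵇ (below k) P ℕ.+ length (ofColour id k P) ℕ.+ countᵇ (above k) P
trichotomy [] k = ≡.refl
trichotomy (p ∷ P) k
  rewrite trichotomy P k | countᵇ-∷ (below k) p P | countᵇ-∷ (above k) p P
        | LP.filter-++ (λ c → c Fin.≟ k) [ p ] P | LP.length-++ (ofColour id k [ p ]) {ofColour id k P} = begin
  1 ℕ.+ (a ℕ.+ b ℕ.+ c)                               ≡⟨ ≡.cong (ℕ._+ (a ℕ.+ b ℕ.+ c)) (trichotomy₁ p k) ⟩
  a₁ ℕ.+ b₁ ℕ.+ c₁ ℕ.+ (a ℕ.+ b ℕ.+ c)                ≡⟨ lemma a₁ b₁ c₁ a b c ⟩
  a₁ ℕ.+ a ℕ.+ (b₁ ℕ.+ b) ℕ.+ (c₁ ℕ.+ c)              ∎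
  where
  open ≡.≡-Reasoning
  a = countᵇ (below k) P
  b = length (ofColour id k P)
  c = countᵇ (above k) P
  a₁ = indicator (below k) p
  b₁ = length (ofColour id k [ p ])
  c₁ = indicator (above k) p
  lemma : ∀ a₁ b₁ c₁ a b c → a₁ ℕ.+ b₁ ℕ.+ c₁ ℕ.+ (a ℕ.+ b ℕ.+ c) ≡ a₁ ℕ.+ a ℕ.+ (b₁ ℕ.+ b) ℕ.+ (c₁ ℕ.+ c)
  lemma = solve-∀

length-ofColour-map : ∀ {A : Set} {d} (f : A → Fin d) k xs → length (ofColour id k (map f xs)) ≡ length (ofColour f k xs)
length-ofColour-map f k [] = ≡.refl
length-ofColour-map f k (x ∷ xs) with f x Fin.≟ k
... | yes _ = ≡.cong ℕ.suc (length-ofColour-map f k xs)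
... | no _  = length-ofColour-map f k xs

-- Moving the letter of colour k to the front: the right-hand side differs from the left by twice the number of
-- letters of colour below k after it.
inv-peel : ∀ {d} (S P : List (Fin d)) k Q → countᵇ (below k) S ≡ countᵇ (below k) (P ++ Q) →
  inv (k ∷ S) ℕ.+ inv (P ++ k ∷ Q) ℕ.+ length (ofColour id k P)
  ≡ 2 ℕ.* countᵇ (below k) Q ℕ.+ (length P ℕ.+ inv S ℕ.+ inv (P ++ Q))
inv-peel S P k Q e rewrite e | inv-insert P k Q | trichotomy P k | countᵇ-++ (below k) P Q =
  lemma (countᵇ (below k) P) (countᵇ (below k) Q) (inv S) (inv (P ++ Q)) (countᵇ (above k) P) (length (ofColour id k P))
  where
  lemma : ∀ a b s i c l → a ℕ.+ b ℕ.+ s ℕ.+ (i ℕ.+ (c ℕ.+ b)) ℕ.+ l ≡ 2 ℕ.* b ℕ.+ (a ℕ.+ l ℕ.+ c ℕ.+ s ℕ.+ i)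
  lemma = solve-∀

-- Boolean tests, sorted lists and flattened tableaux

⌊⌋-⇔ : ∀ {p q} {P : Set p} {Q : Set q} → (P → Q) → (Q → P) → (P? : Dec P) (Q? : Dec Q) → ⌊ P? ⌋ ≡ ⌊ Q? ⌋
⌊⌋-⇔ f g (yes p) (yes q) = ≡.refl
⌊⌋-⇔ f g (yes p) (no ¬q) = contradiction (f p) ¬q
⌊⌋-⇔ f g (no ¬p) (yes q) = contradiction (g q) ¬p
⌊⌋-⇔ f g (no ¬p) (no ¬q) = ≡.refl

allᵇ-map : ∀ {A B : Set} (p : B → Bool) (h : A → B) xs → allᵇ p (map h xs) ≡ allᵇ (p ∘ h) xs
allᵇ-map p h [] = ≡.refl
allᵇ-map p h (x ∷ xs) = ≡.cong (p (h x) ∧_) (allᵇ-map p h xs)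

tabulate≡map-allFin : ∀ {a} {A : Set a} {m} (h : Fin m → A) → tabulate h ≡ map h (allFin m)
tabulate≡map-allFin h = ≡.sym (LP.map-tabulate id h)

allᵇ-suc : ∀ {m} (p : Fin (ℕ.suc m) → Bool) → allᵇ p (allFin (ℕ.suc m)) ≡ p zero ∧ allᵇ (p ∘ suc) (allFin m)
allᵇ-suc p = ≡.cong (p zero ∧_) (≡.trans (≡.cong (allᵇ p) (tabulate≡map-allFin suc)) (allᵇ-map p suc (allFin _)))

allᵇ-cong : ∀ {A : Set} {p q : A → Bool} → (∀ x → p x ≡ q x) → ∀ xs → allᵇ p xs ≡ allᵇ q xs
allᵇ-cong e [] = ≡.refl
allᵇ-cong e (x ∷ xs) = ≡.cong₂ _∧_ (e x) (allᵇ-cong e xs)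

allᵇ-elim : ∀ {A : Set} (p : A → Bool) {xs} → allᵇ p xs ≡ true → ∀ {x} → x ∈ xs → p x ≡ true
allᵇ-elim p {x ∷ xs} e x∈ with p x in px
allᵇ-elim p {x ∷ xs} e (here ≡.refl) | true = px
allᵇ-elim p {x ∷ xs} e (there x∈) | true = allᵇ-elim p e x∈

allᵇ-intro : ∀ {A : Set} (p : A → Bool) → (∀ x → p x ≡ true) → ∀ xs → allᵇ p xs ≡ true
allᵇ-intro p e [] = ≡.refl
allᵇ-intro p e (x ∷ xs) = ≡.cong₂ _∧_ (e x) (allᵇ-intro p e xs)

AllPairs-delete : ∀ {a ℓ} {A : Set a} {_~_ : A → A → Set ℓ} pre {c post} → AllPairs _~_ (pre ++ c ∷ post) →
  All (_~ c) pre × All (c ~_) post × AllPairs _~_ (pre ++ post)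
AllPairs-delete [] (c~ ∷ sorted) = [] , c~ , sorted
AllPairs-delete (x ∷ pre) (x~ ∷ sorted) with AllPairs-delete pre sorted | AllP.++⁻ pre x~
... | pre~ , post~ , sorted′ | x~pre , (x~c ∷ x~post) = x~c ∷ pre~ , post~ , AllP.++⁺ x~pre x~post ∷ sorted′

countᵇ-all : ∀ {A : Set} (p : A → Bool) {xs} → All (λ x → p x ≡ true) xs → countᵇ p xs ≡ length xs
countᵇ-all p [] = ≡.refl
countᵇ-all p {x ∷ xs} (px ∷ pxs) = ≡.trans (countᵇ-∷ p x xs) (≡.cong₂ ℕ._+_ (≡.cong (if_then 1 else 0) px) (countᵇ-all p pxs))

countᵇ-none : ∀ {A : Set} (p : A → Bool) {xs} → All (λ x → p x ≡ false) xs → countᵇ p xs ≡ 0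
countᵇ-none p [] = ≡.refl
countᵇ-none p {x ∷ xs} (px ∷ pxs) = ≡.trans (countᵇ-∷ p x xs) (≡.cong₂ ℕ._+_ (≡.cong (if_then 1 else 0) px) (countᵇ-none p pxs))

first-of-colour : ∀ {A : Set} {d} (f : A → Fin d) k cs → length (ofColour f k cs) ≢ 0 →
  ∃₂ λ pre c → ∃ λ post → cs ≡ pre ++ c ∷ post × f c ≡ k × ofColour f k pre ≡ []
first-of-colour f k [] ≢0 = contradiction ≡.refl ≢0
first-of-colour f k (c ∷ cs) ≢0 with f c Fin.≟ k in dec
... | yes fc≡k = [] , c , cs , ≡.refl , fc≡k , ≡.refl
... | no fc≢k with first-of-colour f k cs ≢0
...   | pre , c′ , post , ≡.refl , fc′≡k , none =
  c ∷ pre , c′ , post , ≡.refl , fc′≡k , ≡.trans (ofColour-≢ f c pre fc≢k) none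

-- A filled cell is recorded as ((row , column) , entry); a tableau is flattened to its filled cells in reading order.

module _ {A X : Set} {d : ℕ} where

  -- The map `h` returns the original column of each remaining cell, so that the recursion can pass
  -- to the tail of a row; a whole row has `h = id`. The map `l` of `flatten` does the same for
  -- rows.
  flatRow : ∀ {e} → A → (Fin e → Fin d) → Vec (Maybe X) e → List ((A × Fin d) × X)
  flatRow ρ h V.[] = []
  flatRow ρ h (nothing V.∷ row) = flatRow ρ (h ∘ suc) row
  flatRow ρ h (just x V.∷ row) = ((ρ , h zero) , x) ∷ flatRow ρ (h ∘ suc) row

  flatten : ∀ {m} → (Fin m → A) → Vec (Vec (Maybe X) d) m → List ((A × Fin d) × X)
  flatten l V.[] = []
  flatten l (row V.∷ T) = flatRow (l zero) id row ++ flatten (l ∘ suc) T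

  column : (A × Fin d) × X → Fin d
  column = proj₂ ∘ proj₁

  flatRow-word : ∀ {e} ρ (h : Fin e → Fin d) row → map proj₂ (flatRow ρ h row) ≡ catMaybes (V.toList row)
  flatRow-word ρ h V.[] = ≡.refl
  flatRow-word ρ h (nothing V.∷ row) = flatRow-word ρ (h ∘ suc) row
  flatRow-word ρ h (just x V.∷ row) = ≡.cong (x ∷_) (flatRow-word ρ (h ∘ suc) row)

  flatten-word : ∀ {m} (l : Fin m → A) T → map proj₂ (flatten l T) ≡ concatMap (catMaybes ∘ V.toList) (V.toList T)
  flatten-word l V.[] = ≡.refl
  flatten-word l (row V.∷ T) = ≡.trans (LP.map-++ proj₂ (flatRow (l zero) id row) _)
    (≡.cong₂ _++_ (flatRow-word (l zero) id row) (flatten-word (l ∘ suc) T))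

  entry : A → Fin d → Maybe X → List ((A × Fin d) × X)
  entry ρ j (just x) = [ ((ρ , j) , x) ]
  entry ρ j nothing = []

  flatRow-avoid : ∀ {e} ρ (h : Fin e → Fin d) j → (∀ i → h i ≢ j) → ∀ row → ofColour column j (flatRow ρ h row) ≡ []
  flatRow-avoid ρ h j ≢j V.[] = ≡.refl
  flatRow-avoid ρ h j ≢j (nothing V.∷ row) = flatRow-avoid ρ (h ∘ suc) j (≢j ∘ suc) row
  flatRow-avoid ρ h j ≢j (just x V.∷ row) =
    ≡.trans (ofColour-≢ column _ (flatRow ρ (h ∘ suc) row) (≢j zero)) (flatRow-avoid ρ (h ∘ suc) j (≢j ∘ suc) row)

  flatRow-column : ∀ {e} ρ (h : Fin e → Fin d) → (∀ {i j} → h i ≡ h j → i ≡ j) → ∀ i row →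
    ofColour column (h i) (flatRow ρ h row) ≡ entry ρ (h i) (V.lookup row i)
  flatRow-column ρ h inj zero (nothing V.∷ row) = flatRow-avoid ρ (h ∘ suc) (h zero) (λ i e → contradiction (inj e) λ ()) row
  flatRow-column ρ h inj zero (just x V.∷ row) =
    ≡.trans (ofColour-≡ column ((ρ , h zero) , x) (flatRow ρ (h ∘ suc) row) ≡.refl)
      (≡.cong (((ρ , h zero) , x) ∷_) (flatRow-avoid ρ (h ∘ suc) (h zero) (λ i e → contradiction (inj e) λ ()) row))
  flatRow-column ρ h inj (suc i) (nothing V.∷ row) = flatRow-column ρ (h ∘ suc) (FinP.suc-injective ∘ inj) i row
  flatRow-column ρ h inj (suc i) (just x V.∷ row) =
    ≡.trans (ofColour-≢ column ((ρ , h zero) , x) (flatRow ρ (h ∘ suc) row) (λ e → contradiction (inj e) λ ()))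
      (flatRow-column ρ (h ∘ suc) (FinP.suc-injective ∘ inj) i row)

  flatten-column-∷ : ∀ {m} (l : Fin (ℕ.suc m) → A) j row T →
    ofColour column j (flatten l (row V.∷ T)) ≡ entry (l zero) j (V.lookup row j) ++ ofColour column j (flatten (l ∘ suc) T)
  flatten-column-∷ l j row T = ≡.trans (LP.filter-++ _ (flatRow (l zero) id row) (flatten (l ∘ suc) T))
    (≡.cong (_++ ofColour column j (flatten (l ∘ suc) T)) (flatRow-column (l zero) id id j row))

  flatten-columnEntries : ∀ {m} (l : Fin m → A) j T →
    map proj₂ (ofColour column j (flatten l T)) ≡ catMaybes (V.toList (V.map (λ row → V.lookup row j) T))
  flatten-columnEntries l j V.[] = ≡.refl
  flatten-columnEntries l j (row V.∷ T) with V.lookup row j | flatten-column-∷ l j row T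
  ... | nothing | e = ≡.trans (≡.cong (map proj₂) e) (flatten-columnEntries (l ∘ suc) j T)
  ... | just x  | e = ≡.trans (≡.cong (map proj₂) e) (≡.cong (x ∷_) (flatten-columnEntries (l ∘ suc) j T))

  -- For `l = id` this recovers the row set of column `j`, before its indices are embedded into
  -- those of the matrix.
  flatten-rows : ∀ {m} (l : Fin m → A) j T →
    map (proj₁ ∘ proj₁) (ofColour column j (flatten l T))
    ≡ map l (filterᵇ (λ i → is-just (V.lookup (V.lookup T i) j)) (allFin m))
  flatten-rows l j V.[] = ≡.refl
  flatten-rows {ℕ.suc m} l j (row V.∷ T) = ≡.trans split (≡.sym rest)
    where
    filled : Fin (ℕ.suc m) → Bool
    filled i = is-just (V.lookup (V.lookup (row V.∷ T) i) j)
    tail-rows : map l (filterᵇ filled (tabulate suc)) ≡ map (proj₁ ∘ proj₁) (ofColour column j (flatten (l ∘ suc) T))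
    tail-rows = ≡.trans (≡.cong (λ is → map l (filterᵇ filled is)) (tabulate≡map-allFin suc))
      (≡.trans (filterᵇ-map (allFin m)) (≡.sym (flatten-rows (l ∘ suc) j T)))
      where
      filterᵇ-map : ∀ is → map l (filterᵇ filled (map suc is)) ≡ map (l ∘ suc) (filterᵇ (filled ∘ suc) is)
      filterᵇ-map [] = ≡.refl
      filterᵇ-map (i ∷ is) with filled (suc i)
      ... | true  = ≡.cong (l (suc i) ∷_) (filterᵇ-map is)
      ... | false = filterᵇ-map is
    split : map (proj₁ ∘ proj₁) (ofColour column j (flatten l (row V.∷ T)))
          ≡ map (proj₁ ∘ proj₁) (entry (l zero) j (V.lookup row j)) ++ map (proj₁ ∘ proj₁) (ofColour column j (flatten (l ∘ suc) T))
    split = ≡.trans (≡.cong (map (proj₁ ∘ proj₁)) (flatten-column-∷ l j row T)) (LP.map-++ _ (entry (l zero) j (V.lookup row j)) _)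
    rest : map l (filterᵇ filled (allFin (ℕ.suc m)))
          ≡ map (proj₁ ∘ proj₁) (entry (l zero) j (V.lookup row j)) ++ map (proj₁ ∘ proj₁) (ofColour column j (flatten (l ∘ suc) T))
    rest with V.lookup row j
    ... | nothing = tail-rows
    ... | just x  = ≡.cong (l zero ∷_) tail-rows

ofColour-map-suc : ∀ {d} (j : Fin d) xs → ofColour id (suc j) (map suc xs) ≡ map suc (ofColour id j xs)
ofColour-map-suc j [] = ≡.refl
ofColour-map-suc j (x ∷ xs) with x Fin.≟ j
... | yes _ = ≡.cong (suc x ∷_) (ofColour-map-suc j xs)
... | no _  = ofColour-map-suc j xs

ofColour-allFin : ∀ {d} (j : Fin d) → ofColour id j (allFin d) ≡ [ j ]
ofColour-allFin zero = ≡.cong (zero ∷_) (≡.trans (≡.cong (ofColour id zero) (tabulate≡map-allFin suc)) (no-zero (allFin _)))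
  where
  no-zero : ∀ {d} (xs : List (Fin d)) → ofColour id zero (map suc xs) ≡ []
  no-zero [] = ≡.refl
  no-zero (x ∷ xs) = no-zero xs
ofColour-allFin (suc j) = ≡.trans (≡.cong (ofColour id (suc j)) (tabulate≡map-allFin suc))
  (≡.trans (ofColour-map-suc j (allFin _)) (≡.cong (map suc) (ofColour-allFin j)))

-- Sums, alternating sums and determinants over a commutative ring

module Determinant {c ℓ} (R : CommutativeRing c ℓ) where
  open CommutativeRing R hiding (zero) renaming (Carrier to K)
  open RingP ring using (-‿distribˡ-*; -‿distribʳ-*; -‿involutive; -0#≈0#; -‿+-comm)
  open CSP +-commutativeSemigroup using () renaming (interchange to +-interchange)
  open CSP *-commutativeSemigroup using () renaming (x∙yz≈y∙xz to x*yz≈y*xz)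
  open import Relation.Binary.Reasoning.Setoid setoid
  open FinFold +-commutativeMonoid using () renaming (fold-indicator to ∑-indicator; fold-suc to ∑-suc)
  open FinFold *-commutativeMonoid using (except; except-cong) renaming (fold to ∏; fold-cong to ∏-cong; fold-except to ∏-except; fold-ε to ∏-1)

  -- Finite sums over lists

  Σ : ∀ {a} {A : Set a} → (A → K) → List A → K
  Σ F xs = foldr _+_ 0# (map F xs)

  module _ {a} {A : Set a} where

    Σ-cong-∈ : ∀ {F G : A → K} xs → (∀ {x} → x ∈ xs → F x ≈ G x) → Σ F xs ≈ Σ G xs
    Σ-cong-∈ [] e = refl
    Σ-cong-∈ (x ∷ xs) e = +-cong (e (here ≡.refl)) (Σ-cong-∈ xs (e ∘ there))

    Σ-cong : ∀ {F G : A → K} → (∀ x → F x ≈ G x) → ∀ xs → Σ F xs ≈ Σ G xs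
    Σ-cong e xs = Σ-cong-∈ xs λ {x} _ → e x

    Σ-++ : ∀ (F : A → K) xs ys → Σ F (xs ++ ys) ≈ Σ F xs + Σ F ys
    Σ-++ F [] ys = sym (+-identityˡ _)
    Σ-++ F (x ∷ xs) ys = trans (+-congˡ (Σ-++ F xs ys)) (sym (+-assoc _ _ _))

    Σ-0 : ∀ (xs : List A) → Σ (λ _ → 0#) xs ≈ 0#
    Σ-0 [] = refl
    Σ-0 (x ∷ xs) = trans (+-identityˡ _) (Σ-0 xs)

    Σ-+ : ∀ (F G : A → K) xs → Σ (λ x → F x + G x) xs ≈ Σ F xs + Σ G xs
    Σ-+ F G [] = sym (+-identityˡ _)
    Σ-+ F G (x ∷ xs) = trans (+-congˡ (Σ-+ F G xs)) (+-interchange _ _ _ _)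

    Σ-*ˡ : ∀ k (F : A → K) xs → Σ (λ x → k * F x) xs ≈ k * Σ F xs
    Σ-*ˡ k F [] = sym (zeroʳ k)
    Σ-*ˡ k F (x ∷ xs) = trans (+-congˡ (Σ-*ˡ k F xs)) (sym (distribˡ k _ _))

    Σ-*ʳ : ∀ (F : A → K) k xs → Σ (λ x → F x * k) xs ≈ Σ F xs * k
    Σ-*ʳ F k xs = trans (Σ-cong (λ x → *-comm (F x) k) xs) (trans (Σ-*ˡ k F xs) (*-comm k _))

    Σ-neg : ∀ (F : A → K) xs → Σ (λ x → - F x) xs ≈ - Σ F xs
    Σ-neg F [] = sym -0#≈0#
    Σ-neg F (x ∷ xs) = trans (+-congˡ (Σ-neg F xs)) (-‿+-comm _ _)

    Σ-filterᵇ : ∀ (p : A → Bool) (F : A → K) xs → Σ F (filterᵇ p xs) ≈ Σ (λ x → if p x then F x else 0#) xs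
    Σ-filterᵇ p F [] = refl
    Σ-filterᵇ p F (x ∷ xs) with p x
    ... | true  = +-congˡ (Σ-filterᵇ p F xs)
    ... | false = trans (Σ-filterᵇ p F xs) (sym (+-identityˡ _))

  module _ {a b} {A : Set a} {B : Set b} where

    Σ-map : ∀ (F : B → K) (h : A → B) xs → Σ F (map h xs) ≈ Σ (F ∘ h) xs
    Σ-map F h xs = reflexive (≡.cong (foldr _+_ 0#) (≡.sym (LP.map-∘ xs)))

    Σ-concatMap : ∀ (F : B → K) (h : A → List B) xs → Σ F (concatMap h xs) ≈ Σ (λ x → Σ F (h x)) xs
    Σ-concatMap F h [] = refl
    Σ-concatMap F h (x ∷ xs) = trans (Σ-++ F (h x) (concatMap h xs)) (+-congˡ (Σ-concatMap F h xs))

    Σ-swap : ∀ (F : A → B → K) xs ys → Σ (λ x → Σ (F x) ys) xs ≈ Σ (λ y → Σ (λ x → F x y) xs) ys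
    Σ-swap F [] ys = sym (Σ-0 ys)
    Σ-swap F (x ∷ xs) ys = trans (+-congˡ (Σ-swap F xs ys)) (sym (Σ-+ (F x) _ ys))

  x-0≈x : ∀ x → x - 0# ≈ x
  x-0≈x x = trans (+-congˡ -0#≈0#) (+-identityʳ x)

  -‿distrib-- : ∀ x y z w → (x + y) - (z + w) ≈ (x - z) + (y - w)
  -‿distrib-- x y z w = trans (+-congˡ (sym (-‿+-comm z w))) (+-interchange x y (- z) (- w))

  x*[y-z]≈x*y-x*z : ∀ x y z → x * (y - z) ≈ x * y - x * z
  x*[y-z]≈x*y-x*z x y z = trans (distribˡ x y (- z)) (+-congˡ (sym (-‿distribʳ-* x z)))

  sgn : ℕ → K
  sgn ℕ.zero = 1#
  sgn (ℕ.suc k) = - sgn k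

  sgn-+ : ∀ a b → sgn (a ℕ.+ b) ≈ sgn a * sgn b
  sgn-+ ℕ.zero b = sym (*-identityˡ _)
  sgn-+ (ℕ.suc a) b = trans (-‿cong (sgn-+ a b)) (-‿distribˡ-* _ _)

  sgn-even : ∀ a → sgn (2 ℕ.* a) ≈ 1#
  sgn-even a rewrite ℕP.+-identityʳ a = trans (sgn-+ a a) (square a)
    where
    square : ∀ a → sgn a * sgn a ≈ 1#
    square ℕ.zero = *-identityˡ 1#
    square (ℕ.suc a) = begin
      - sgn a * - sgn a     ≈⟨ -‿distribˡ-* _ _ ⟨
      - (sgn a * - sgn a)   ≈⟨ -‿cong (sym (-‿distribʳ-* _ _)) ⟩
      - - (sgn a * sgn a)   ≈⟨ -‿involutive _ ⟩
      sgn a * sgn a         ≈⟨ square a ⟩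
      1#                    ∎

  sgn-≡ : ∀ a {b c} → b ≡ 2 ℕ.* a ℕ.+ c → sgn b ≈ sgn c
  sgn-≡ a {c = c} ≡.refl = trans (sgn-+ (2 ℕ.* a) c) (trans (*-congʳ (sgn-even a)) (*-identityˡ _))

  -- Alternating sums over the ways to delete one element of a list

  module _ {a} {C : Set a} where

    -- The signs come from nested subtraction, without a position counter or an accumulated prefix:
    -- only `g` changes in the recursion.
    alt : (C → List C → K) → List C → K
    alt g [] = 0#
    alt g (c ∷ cs) = g c cs - alt (λ c′ cs′ → g c′ (c ∷ cs′)) cs

    -- With the hypothesis limited to actual splittings, facts about `cs` such as its length pass to
    -- `pre ++ post`.
    alt-cong-split : ∀ {g h : C → List C → K} cs →
      (∀ pre c post → cs ≡ pre ++ c ∷ post → g c (pre ++ post) ≈ h c (pre ++ post)) → alt g cs ≈ alt h cs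
    alt-cong-split [] e = refl
    alt-cong-split (c ∷ cs) e = +-cong (e [] c cs ≡.refl)
      (-‿cong (alt-cong-split cs λ pre c′ post eq → e (c ∷ pre) c′ post (≡.cong (c ∷_) eq)))

    alt-cong : ∀ {g h : C → List C → K} → (∀ c cs → g c cs ≈ h c cs) → ∀ cs → alt g cs ≈ alt h cs
    alt-cong e cs = alt-cong-split cs λ pre c post _ → e c (pre ++ post)

    alt-0 : ∀ cs → alt (λ _ _ → 0#) cs ≈ 0#
    alt-0 [] = refl
    alt-0 (c ∷ cs) = trans (+-congˡ (-‿cong (alt-0 cs))) (x-0≈x 0#)

    alt-+ : ∀ (g h : C → List C → K) cs → alt (λ c cs → g c cs + h c cs) cs ≈ alt g cs + alt h cs
    alt-+ g h [] = sym (+-identityˡ _)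
    alt-+ g h (c ∷ cs) = trans (+-congˡ (-‿cong (alt-+ _ _ cs))) (-‿distrib-- _ _ _ _)

    alt-*ˡ : ∀ k (g : C → List C → K) cs → alt (λ c cs → k * g c cs) cs ≈ k * alt g cs
    alt-*ˡ k g [] = sym (zeroʳ k)
    alt-*ˡ k g (c ∷ cs) = trans (+-congˡ (-‿cong (alt-*ˡ k _ cs))) (sym (x*[y-z]≈x*y-x*z _ _ _))

    alt-neg : ∀ (g : C → List C → K) cs → alt (λ c cs → - g c cs) cs ≈ - alt g cs
    alt-neg g [] = sym -0#≈0#
    alt-neg g (c ∷ cs) = trans (+-congˡ (-‿cong (alt-neg _ cs))) (-‿+-comm _ _)

    alt-Σ : ∀ {i} {I : Set i} (g : I → C → List C → K) ks cs →
      alt (λ c cs → Σ (λ k → g k c cs) ks) cs ≈ Σ (λ k → alt (g k) cs) ks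
    alt-Σ g [] cs = alt-0 cs
    alt-Σ g (k ∷ ks) cs = trans (alt-+ (g k) _ cs) (+-congˡ (alt-Σ g ks cs))

    -- Deleting two elements in either order leaves the same list, but with opposite signs. In the
    -- induction the pairs with the head first cancel those with the head second, and the pairs
    -- without the head cancel by hypothesis.
    alt-alt-symmetric : ∀ (H : C → C → List C → K) → (∀ a b cs → H a b cs ≈ H b a cs) →
      ∀ cs → alt (λ a → alt (H a)) cs ≈ 0#
    alt-alt-symmetric H s [] = refl
    alt-alt-symmetric H s (c ∷ cs) = begin
      alt (H c) cs - alt (λ a cs → H a c cs - alt (λ b cs → H a b (c ∷ cs)) cs) cs
        ≈⟨ +-congˡ (-‿cong (trans (alt-+ _ _ cs) (+-congˡ (alt-neg _ cs)))) ⟩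
      alt (H c) cs - (alt (λ a → H a c) cs - alt (λ a → alt (λ b cs → H a b (c ∷ cs))) cs)
        ≈⟨ +-congˡ (-‿cong (+-congˡ (-‿cong (alt-alt-symmetric _ (λ a b cs → s a b (c ∷ cs)) cs)))) ⟩
      alt (H c) cs - (alt (λ a → H a c) cs - 0#)
        ≈⟨ +-congˡ (-‿cong (x-0≈x _)) ⟩
      alt (H c) cs - alt (λ a → H a c) cs
        ≈⟨ +-congˡ (-‿cong (alt-cong (λ a → s a c) cs)) ⟩
      alt (H c) cs - alt (H c) cs
        ≈⟨ -‿inverseʳ _ ⟩
      0# ∎

    -- Unlike `alt`, the summand sees the prefix. This is needed to compare the position of a column
    -- among all columns with its position among those of its own colour.
    splitSum : (List C → C → List C → K) → List C → K
    splitSum φ [] = 0#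
    splitSum φ (c ∷ cs) = φ [] c cs + splitSum (λ pre → φ (c ∷ pre)) cs

    splitSum-cong : ∀ {φ ψ : List C → C → List C → K} cs →
      (∀ pre c post → cs ≡ pre ++ c ∷ post → φ pre c post ≈ ψ pre c post) → splitSum φ cs ≈ splitSum ψ cs
    splitSum-cong [] e = refl
    splitSum-cong (c ∷ cs) e = +-cong (e [] c cs ≡.refl)
      (splitSum-cong cs λ pre c′ post eq → e (c ∷ pre) c′ post (≡.cong (c ∷_) eq))

    splitSum-*ˡ : ∀ k φ cs → splitSum (λ pre c post → k * φ pre c post) cs ≈ k * splitSum φ cs
    splitSum-*ˡ k φ [] = sym (zeroʳ k)
    splitSum-*ˡ k φ (c ∷ cs) = trans (+-congˡ (splitSum-*ˡ k _ cs)) (sym (distribˡ k _ _))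

    splitSum-neg : ∀ φ cs → splitSum (λ pre c post → - φ pre c post) cs ≈ - splitSum φ cs
    splitSum-neg φ [] = sym -0#≈0#
    splitSum-neg φ (c ∷ cs) = trans (+-congˡ (splitSum-neg _ cs)) (-‿+-comm _ _)

    alt-splitSum : ∀ g cs → alt g cs ≈ splitSum (λ pre c post → sgn (length pre) * g c (pre ++ post)) cs
    alt-splitSum g [] = refl
    alt-splitSum g (c ∷ cs) = +-cong (sym (*-identityˡ _)) (begin
      - alt (λ c′ cs′ → g c′ (c ∷ cs′)) cs
        ≈⟨ -‿cong (alt-splitSum _ cs) ⟩
      - splitSum (λ pre c′ post → sgn (length pre) * g c′ (c ∷ pre ++ post)) cs
        ≈⟨ splitSum-neg _ cs ⟨
      splitSum (λ pre c′ post → - (sgn (length pre) * g c′ (c ∷ pre ++ post))) cs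
        ≈⟨ splitSum-cong cs (λ pre c′ post _ → -‿distribˡ-* _ _) ⟩
      splitSum (λ pre c′ post → - sgn (length pre) * g c′ (c ∷ pre ++ post)) cs ∎)

    -- The splittings of the subsequence of colour `k` correspond to those splittings of `cs` whose
    -- middle element has colour `k`.
    splitSum-ofColour : ∀ {d} (f : C → Fin d) k φ cs → splitSum φ (ofColour f k cs)
      ≈ splitSum (λ pre c post → if ⌊ f c Fin.≟ k ⌋ then φ (ofColour f k pre) c (ofColour f k post) else 0#) cs
    splitSum-ofColour f k φ [] = refl
    splitSum-ofColour f k φ (c ∷ cs) with f c Fin.≟ k
    ... | yes _ = +-congˡ (splitSum-ofColour f k _ cs)
    ... | no _  = trans (splitSum-ofColour f k φ cs) (sym (+-identityˡ _))

  alt-map : ∀ {a b} {B : Set a} {C : Set b} (h : B → C) (g : C → List C → K) bs → alt g (map h bs) ≈ alt (λ b bs′ → g (h b) (map h bs′)) bs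
  alt-map h g [] = refl
  alt-map h g (b ∷ bs) = +-congˡ (-‿cong (alt-map h _ bs))

  -- Determinants

  module _ {a} {C : Set a} where

    -- Rows are functions of a column, so a cofactor only shortens the two lists. Lists of different
    -- lengths are allowed and give zero (`det-length`).
    det : List (C → K) → List C → K
    det [] [] = 1#
    det [] (_ ∷ _) = 0#
    det (l ∷ ls) cs = alt (λ c cs′ → l c * det ls cs′) cs

    det-congʳ : ∀ pre {X Y : List (C → K)} → (∀ cs → det X cs ≈ det Y cs) → ∀ cs → det (pre ++ X) cs ≈ det (pre ++ Y) cs
    det-congʳ [] e = e
    det-congʳ (p ∷ pre) e = alt-cong λ c cs → *-congˡ (det-congʳ pre e cs)

    det-length : ∀ ls (cs : List C) → length ls ≢ length cs → det ls cs ≈ 0#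
    det-length [] [] n = contradiction ≡.refl n
    det-length [] (_ ∷ _) n = refl
    det-length (l ∷ ls) cs n = trans (alt-cong-split cs λ { pre c post ≡.refl →
        trans (*-congˡ (det-length ls (pre ++ post) λ e → n (≡.trans (≡.cong ℕ.suc e) (length-insert pre)))) (zeroʳ _) })
      (alt-0 cs)
      where
      length-insert : ∀ pre {c : C} {post} → ℕ.suc (length (pre ++ post)) ≡ length (pre ++ c ∷ post)
      length-insert [] = ≡.refl
      length-insert (x ∷ pre) = ≡.cong ℕ.suc (length-insert pre)

    det-Σ-row : ∀ {i} {I : Set i} pre (l : I → C → K) ks post cs →
      det (pre ++ (λ c → Σ (λ k → l k c) ks) ∷ post) cs ≈ Σ (λ k → det (pre ++ l k ∷ post) cs) ks
    det-Σ-row [] l ks post cs = trans (alt-cong (λ c cs → sym (Σ-*ʳ (λ k → l k c) _ ks)) cs) (alt-Σ _ ks cs)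
    det-Σ-row (p ∷ pre) l ks post cs = trans
      (alt-cong (λ c cs → trans (*-congˡ (det-Σ-row pre l ks post cs)) (sym (Σ-*ˡ (p c) _ ks))) cs) (alt-Σ _ ks cs)

    det-adjacent : ∀ a b X cs → det (a ∷ b ∷ X) cs ≈ alt (λ c → alt (λ c′ cs → a c * (b c′ * det X cs))) cs
    det-adjacent a b X = alt-cong λ c cs → sym (alt-*ˡ (a c) _ cs)

    -- The sum is a double alternating sum whose summand is symmetric in the two deleted columns.
    det-swap : ∀ a b X cs → det (a ∷ b ∷ X) cs + det (b ∷ a ∷ X) cs ≈ 0#
    det-swap a b X cs = begin
      det (a ∷ b ∷ X) cs + det (b ∷ a ∷ X) cs
        ≈⟨ +-cong (det-adjacent a b X cs) (det-adjacent b a X cs) ⟩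
      alt (λ c → alt (λ c′ cs → a c * (b c′ * det X cs))) cs + alt (λ c → alt (λ c′ cs → b c * (a c′ * det X cs))) cs
        ≈⟨ alt-+ _ _ cs ⟨
      alt (λ c cs → alt (λ c′ cs → a c * (b c′ * det X cs)) cs + alt (λ c′ cs → b c * (a c′ * det X cs)) cs) cs
        ≈⟨ alt-cong (λ c cs → sym (alt-+ _ _ cs)) cs ⟩
      alt (λ c → alt (λ c′ cs → a c * (b c′ * det X cs) + b c * (a c′ * det X cs))) cs
        ≈⟨ alt-alt-symmetric _ (λ c c′ cs → trans (+-comm _ _) (+-cong (x*yz≈y*xz _ _ _) (x*yz≈y*xz _ _ _))) cs ⟩
      0# ∎

    -- Swapping the first two rows moves the two copies of `a` closer together, behind a row `b`.
    -- Expanding along `b` leaves cofactors that vanish by induction.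
    det-repeat : ∀ a X Y cs → det (a ∷ X ++ a ∷ Y) cs ≈ 0#
    det-repeat a [] Y cs = trans (det-adjacent a a Y cs)
      (alt-alt-symmetric _ (λ c c′ cs → x*yz≈y*xz _ _ _) cs)
    det-repeat a (b ∷ X) Y cs = begin
      det (a ∷ b ∷ X ++ a ∷ Y) cs                                       ≈⟨ +-identityʳ _ ⟨
      det (a ∷ b ∷ X ++ a ∷ Y) cs + 0#                                  ≈⟨ +-congˡ (alt-0 cs) ⟨
      det (a ∷ b ∷ X ++ a ∷ Y) cs + alt (λ _ _ → 0#) cs                 ≈⟨ +-congˡ (alt-cong (λ c cs → trans (*-congˡ (det-repeat a X Y cs)) (zeroʳ _)) cs) ⟨
      det (a ∷ b ∷ X ++ a ∷ Y) cs + det (b ∷ a ∷ X ++ a ∷ Y) cs         ≈⟨ det-swap a b (X ++ a ∷ Y) cs ⟩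
      0#                                                                ∎

    -- By linearity the two sides differ by determinants with a repeated row.
    det-add-rows : ∀ {i} {I : Set i} {a b : C → K} (l : I → C → K) ks → (∀ c → a c ≈ b c + Σ (λ k → l k c) ks) →
      ∀ Y cs → det (a ∷ map l ks ++ Y) cs ≈ det (b ∷ map l ks ++ Y) cs
    det-add-rows {a = a} {b} l ks e Y cs = begin
      alt (λ c cs → a c * det X cs) cs
        ≈⟨ alt-cong (λ c cs → trans (*-congʳ (e c)) (distribʳ _ _ _)) cs ⟩
      alt (λ c cs → b c * det X cs + Σ (λ k → l k c) ks * det X cs) cs
        ≈⟨ alt-+ _ _ cs ⟩
      det (b ∷ X) cs + det ((λ c → Σ (λ k → l k c) ks) ∷ X) cs
        ≈⟨ +-congˡ (trans (det-Σ-row [] l ks X cs) (trans (Σ-cong-∈ ks repeated) (Σ-0 ks))) ⟩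
      det (b ∷ X) cs + 0#
        ≈⟨ +-identityʳ _ ⟩
      det (b ∷ X) cs ∎
      where
      X = map l ks ++ Y
      repeated : ∀ {k} → k ∈ ks → det (l k ∷ X) cs ≈ 0#
      repeated {k} k∈ks with ∈-∃++ k∈ks
      ... | ys , zs , ≡.refl
        rewrite LP.map-++ l ys (k ∷ zs) | LP.++-assoc (map l ys) (l k ∷ map l zs) Y =
        det-repeat (l k) (map l ys) (map l zs ++ Y) cs

    det-rows-cong : ∀ {i} {I : Set i} {F G : I → C → K} {P : C → Set} → (∀ x {c} → P c → F x c ≈ G x c) →
      ∀ xs {cs} → All P cs → det (map F xs) cs ≈ det (map G xs) cs
    det-rows-cong e [] {[]} _ = refl
    det-rows-cong e [] {_ ∷ _} _ = refl
    det-rows-cong {F = F} {G} {P} e (x ∷ xs) {cs} all = alt-cong-split cs (λ { pre c post ≡.refl → case-split pre all })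
      where
      case-split : ∀ pre {c post} → All P (pre ++ c ∷ post) → F x c * det (map F xs) (pre ++ post) ≈ G x c * det (map G xs) (pre ++ post)
      case-split pre all with AllP.++⁻ pre all
      ... | all-pre , Pc ∷ all-post = *-cong (e x Pc) (det-rows-cong e xs (AllP.++⁺ all-pre all-post))

    det-zero-column : ∀ {i} {I : Set i} {F : I → C → K} {P : C → Set} → (∀ x {c} → P c → F x c ≈ 0#) →
      ∀ xs {cs} → Any P cs → det (map F xs) cs ≈ 0#
    det-zero-column e [] {_ ∷ _} _ = refl
    det-zero-column {F = F} {P} e (x ∷ xs) {cs} any = trans (alt-cong-split cs λ { pre c post ≡.refl → case-split pre any }) (alt-0 cs)
      where
      case-split : ∀ pre {c post} → Any P (pre ++ c ∷ post) → F x c * det (map F xs) (pre ++ post) ≈ 0#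
      case-split pre any with AnyP.++⁻ pre any
      ... | inj₁ p = trans (*-congˡ (det-zero-column e xs (AnyP.++⁺ˡ p))) (zeroʳ _)
      ... | inj₂ (here p) = trans (*-congʳ (e x p)) (zeroˡ _)
      ... | inj₂ (there p) = trans (*-congˡ (det-zero-column e xs (AnyP.++⁺ʳ pre p))) (zeroʳ _)

  det-map : ∀ {a b i} {B : Set a} {C : Set b} {I : Set i} (h : B → C) (F : I → C → K) xs bs →
    det (map F xs) (map h bs) ≈ det (map (λ x → F x ∘ h) xs) bs
  det-map h F [] [] = refl
  det-map h F [] (_ ∷ _) = refl
  det-map h F (x ∷ xs) bs = trans (alt-map h _ bs) (alt-cong (λ b bs → *-congˡ (det-map h F xs bs)) bs)

  -- Factorisation of determinants with coloured rows and columns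

  open CMSolver *-commutativeMonoid using (solve; _⊜_; _⊕_)

  module _ {A C : Set} {d} (κ : A → Fin d) (f : C → Fin d) where

    SameColours? : ∀ σ cs → Dec (SameColours κ σ f cs)
    SameColours? σ cs = FinP.all? λ j → length (ofColour κ j σ) ℕ.≟ length (ofColour f j cs)

    -- The cofactor sign of column `c` is given by its position `length pre` in the whole matrix,
    -- but by its position among the columns of colour `κ a` in its block. The discrepancy is the
    -- change in the inversions of both colour sequences when `a` and `c` are removed. As the
    -- remaining sequences have equal colour counts, the exponents differ by an even number
    -- (`inv-peel`).
    sgn-peel : ∀ a σ pre c post → f c ≡ κ a → SameColours κ σ f (pre ++ post) →
      sgn (length pre) * sgn (inv (map κ σ)) * sgn (inv (map f (pre ++ post)))
      ≈ sgn (inv (map κ (a ∷ σ))) * sgn (inv (map f (pre ++ c ∷ post))) * sgn (length (ofColour f (κ a) pre))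
    sgn-peel a σ pre c post fc≡κa same = begin
      sgn (length pre) * sgn (inv (map κ σ)) * sgn (inv (map f (pre ++ post)))
        ≈⟨ *-congʳ (sgn-+ (length pre) _) ⟨
      sgn (length pre ℕ.+ inv (map κ σ)) * sgn (inv (map f (pre ++ post)))
        ≈⟨ sgn-+ (length pre ℕ.+ inv (map κ σ)) _ ⟨
      sgn (length pre ℕ.+ inv (map κ σ) ℕ.+ inv (map f (pre ++ post)))
        ≈⟨ sgn-≡ (countᵇ (below (κ a)) (map f post)) parity ⟨
      sgn (inv (map κ (a ∷ σ)) ℕ.+ inv (map f (pre ++ c ∷ post)) ℕ.+ length (ofColour f (κ a) pre))
        ≈⟨ sgn-+ (inv (map κ (a ∷ σ)) ℕ.+ _) _ ⟩
      sgn (inv (map κ (a ∷ σ)) ℕ.+ inv (map f (pre ++ c ∷ post))) * sgn (length (ofColour f (κ a) pre))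
        ≈⟨ *-congʳ (sgn-+ (inv (map κ (a ∷ σ))) _) ⟩
      sgn (inv (map κ (a ∷ σ))) * sgn (inv (map f (pre ++ c ∷ post))) * sgn (length (ofColour f (κ a) pre)) ∎
      where
      parity : inv (map κ (a ∷ σ)) ℕ.+ inv (map f (pre ++ c ∷ post)) ℕ.+ length (ofColour f (κ a) pre)
             ≡ 2 ℕ.* countᵇ (below (κ a)) (map f post) ℕ.+ (length pre ℕ.+ inv (map κ σ) ℕ.+ inv (map f (pre ++ post)))
      parity with countᵇ-sameColours {κ = κ} {σ} {f} {pre ++ post} same (below (κ a))
      ... | counts rewrite LP.map-++ f pre (c ∷ post) | LP.map-++ f pre post | fc≡κa
              | ≡.sym (length-ofColour-map f (κ a) pre) | ≡.sym (LP.length-map f pre)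
        = inv-peel (map κ σ) (map f pre) (κ a) (map f post) counts

    ofColour-split : ∀ pre c post {j} → f c ≢ j → ofColour f j (pre ++ c ∷ post) ≡ ofColour f j (pre ++ post)
    ofColour-split pre c post {j} ≢ = ≡.trans (LP.filter-++ _ pre (c ∷ post))
      (≡.trans (≡.cong (ofColour f j pre ++_) (ofColour-≢ f c post ≢)) (≡.sym (LP.filter-++ _ pre post)))

  module Coloured {A C : Set} {d} (x : A → C → K) (κ : A → Fin d) (f : C → Fin d) where

    colouredRow : A → C → K
    colouredRow a c = if ⌊ f c Fin.≟ κ a ⌋ then x a c else 0#

    block : List A → List C → Fin d → K
    block σ cs j = det (map x (ofColour κ j σ)) (ofColour f j cs)

    -- Some block is not square.
    ∏-block-mismatch : ∀ σ cs → ¬ SameColours κ σ f cs → ∏ (block σ cs) ≈ 0#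
    ∏-block-mismatch σ cs ¬same
      with FinP.¬∀⟶∃¬ d _ (λ j → length (ofColour κ j σ) ℕ.≟ length (ofColour f j cs)) ¬same
    ... | j , ≢ = trans (∏-except (block σ cs) j) (trans (*-congʳ (det-length (map x (ofColour κ j σ)) (ofColour f j cs)
                    (≢ ∘ ≡.trans (≡.sym (LP.length-map x (ofColour κ j σ)))))) (zeroˡ _))

    -- Both sides are expanded along the first row. If the colours of the remaining rows and columns do not match,
    -- then both terms vanish.
    det-coloured : ∀ σ cs → det (map colouredRow σ) cs
      ≈ sgn (inv (map κ σ)) * (sgn (inv (map f cs)) * ∏ (block σ cs))
    det-coloured [] [] = sym (trans (*-identityˡ _) (trans (*-identityˡ _) (∏-1 {d})))
    det-coloured [] (c ∷ cs) = sym (trans (*-congˡ (trans (*-congˡ (∏-block-mismatch [] (c ∷ cs) no-match)) (zeroʳ _))) (zeroʳ _))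
      where
      no-match : ¬ SameColours κ [] f (c ∷ cs)
      no-match same with () ← ≡.trans (same (f c)) (≡.cong length (ofColour-≡ f c cs ≡.refl))
    det-coloured (a ∷ σ) cs = begin
      alt (λ c cs′ → colouredRow a c * det (map colouredRow σ) cs′) cs
        ≈⟨ alt-splitSum _ cs ⟩
      splitSum (λ pre c post → sgn (length pre) * (colouredRow a c * det (map colouredRow σ) (pre ++ post))) cs
        ≈⟨ splitSum-cong cs term ⟩
      splitSum (λ pre c post → s * (t * (P * ψ pre c post))) cs
        ≈⟨ splitSum-*ˡ s _ cs ⟩
      s * splitSum (λ pre c post → t * (P * ψ pre c post)) cs
        ≈⟨ *-congˡ (trans (splitSum-*ˡ t _ cs) (*-congˡ (splitSum-*ˡ P ψ cs))) ⟩
      s * (t * (P * splitSum ψ cs))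
        -- Only columns of colour `k` survive, and their terms form the expansion of block `k` along
        -- its first row.
        ≈⟨ *-congˡ (*-congˡ (*-congˡ (trans (alt-splitSum _ (ofColour f k cs)) (splitSum-ofColour f k _ cs)))) ⟨
      s * (t * (P * det (x a ∷ map x (ofColour κ k σ)) (ofColour f k cs)))
        ≡⟨ ≡.cong (λ y → s * (t * (P * det (map x y) (ofColour f k cs)))) (ofColour-≡ κ a σ ≡.refl) ⟨
      s * (t * (P * block (a ∷ σ) cs k))
        ≈⟨ *-congˡ (*-congˡ (trans (∏-except (block (a ∷ σ) cs) k) (*-comm _ _))) ⟨
      s * (t * ∏ (block (a ∷ σ) cs)) ∎
      where
      k = κ a
      s = sgn (inv (map κ (a ∷ σ)))
      t = sgn (inv (map f cs))
      -- A common factor of all terms: deleting the row `a` and a column of colour `k` leaves the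
      -- other blocks unchanged.
      P = ∏ (except k (block (a ∷ σ) cs))
      ψ : List C → C → List C → K
      ψ pre c post = if ⌊ f c Fin.≟ k ⌋
        then sgn (length (ofColour f k pre)) * (x a c * det (map x (ofColour κ k σ)) (ofColour f k pre ++ ofColour f k post))
        else 0#
      term : ∀ pre c post → cs ≡ pre ++ c ∷ post →
        sgn (length pre) * (colouredRow a c * det (map colouredRow σ) (pre ++ post)) ≈ s * (t * (P * ψ pre c post))
      term pre c post eq with f c Fin.≟ k
      ... | no _ = trans (trans (*-congˡ (zeroˡ _)) (zeroʳ _))
                     (sym (trans (*-congˡ (trans (*-congˡ (zeroʳ _)) (zeroʳ _))) (zeroʳ _)))
      ... | yes fc≡k = begin
        p * (x a c * det (map colouredRow σ) cs′)
          ≈⟨ *-congˡ (*-congˡ (det-coloured σ cs′)) ⟩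
        p * (x a c * (s′ * (t′ * Q)))
          ≈⟨ solve 5 (λ p y s′ t′ Q → (p ⊕ (y ⊕ (s′ ⊕ (t′ ⊕ Q)))) ⊜ ((p ⊕ s′) ⊕ t′) ⊕ (y ⊕ Q)) refl p (x a c) s′ t′ Q ⟩
        p * s′ * t′ * (x a c * Q)
          ≈⟨ signs (SameColours? κ f σ cs′) ⟩
        s * t * q * (x a c * Q)
          ≈⟨ *-congˡ (*-congˡ Q≈) ⟩
        s * t * q * (x a c * (G * P))
          ≈⟨ solve 6 (λ s t q y G P → ((s ⊕ t) ⊕ q) ⊕ (y ⊕ (G ⊕ P)) ⊜ (s ⊕ (t ⊕ (P ⊕ (q ⊕ (y ⊕ G)))))) refl s t q (x a c) G P ⟩
        s * (t * (P * (q * (x a c * G)))) ∎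
        where
        cs′ = pre ++ post
        p = sgn (length pre)
        q = sgn (length (ofColour f k pre))
        s′ = sgn (inv (map κ σ))
        t′ = sgn (inv (map f cs′))
        Q = ∏ (block σ cs′)
        G = det (map x (ofColour κ k σ)) (ofColour f k pre ++ ofColour f k post)
        Q≈ : Q ≈ G * P
        Q≈ = trans (∏-except (block σ cs′) k) (*-cong
          (reflexive (≡.cong (det (map x (ofColour κ k σ))) (LP.filter-++ _ pre post)))
          (∏-cong (except-cong k λ j j≢k → reflexive (≡.cong₂ (λ y z → det (map x y) z)
            (≡.sym (ofColour-≢ κ a σ (j≢k ∘ ≡.sym)))
            (≡.sym (≡.trans (≡.cong (ofColour f j) eq) (ofColour-split κ f pre c post λ fc≡j → j≢k (≡.trans (≡.sym fc≡j) fc≡k))))))))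
        signs : Dec (SameColours κ σ f cs′) → p * s′ * t′ * (x a c * Q) ≈ s * t * q * (x a c * Q)
        signs (yes same) = *-congʳ (trans (sgn-peel κ f a σ pre c post fc≡k same)
          (reflexive (≡.cong (λ z → s * sgn (inv (map f z)) * q) (≡.sym eq))))
        signs (no ¬same) = trans (vanishes _) (sym (vanishes _))
          where
          vanishes : ∀ u → u * (x a c * Q) ≈ 0#
          vanishes u = trans (*-congˡ (trans (*-congˡ (∏-block-mismatch σ cs′ ¬same)) (zeroʳ _))) (zeroʳ _)

  -- Laplace expansion along groups of rows

  module _ {a} {C : Set a} {d : ℕ} where

    -- Colours are attached to the columns themselves, so that deleting a column in `det` also
    -- deletes its colour.
    colouringSum : (List (C × Fin d) → K) → List C → K
    colouringSum F [] = F []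
    colouringSum F (c ∷ cs) = Σ (λ k → colouringSum (λ ps → F ((c , k) ∷ ps)) cs) (allFin d)

    colouringSum-cong : ∀ {F G : List (C × Fin d) → K} → (∀ ps → F ps ≈ G ps) → ∀ cs → colouringSum F cs ≈ colouringSum G cs
    colouringSum-cong e [] = e []
    colouringSum-cong e (c ∷ cs) = Σ-cong (λ k → colouringSum-cong (λ ps → e _) cs) (allFin d)

    colouringSum-sub : ∀ (F G : List (C × Fin d) → K) cs →
      colouringSum (λ ps → F ps - G ps) cs ≈ colouringSum F cs - colouringSum G cs
    colouringSum-sub F G [] = refl
    colouringSum-sub F G (c ∷ cs) = trans (Σ-cong (λ k → colouringSum-sub _ _ cs) (allFin d))
      (trans (Σ-+ _ _ (allFin d)) (+-congˡ (Σ-neg _ (allFin d))))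

    colouringSum-*ˡ : ∀ x (F : List (C × Fin d) → K) cs → colouringSum (λ ps → x * F ps) cs ≈ x * colouringSum F cs
    colouringSum-*ˡ x F [] = refl
    colouringSum-*ˡ x F (c ∷ cs) = trans (Σ-cong (λ k → colouringSum-*ˡ x _ cs) (allFin d)) (Σ-*ˡ x _ (allFin d))

    colouringSum-0 : ∀ cs → colouringSum (λ _ → 0#) cs ≈ 0#
    colouringSum-0 [] = refl
    colouringSum-0 (c ∷ cs) = trans (Σ-cong (λ k → colouringSum-0 cs) (allFin d)) (Σ-0 (allFin d))

    -- Colouring all columns and then deleting one amounts to choosing the deleted column first,
    -- then its colour, then the colours of the others.
    colouringSum-alt : ∀ (H : C → Fin d → List (C × Fin d) → K) cs →
      colouringSum (alt (λ ck → H (proj₁ ck) (proj₂ ck))) cs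
      ≈ alt (λ c cs → Σ (λ k → colouringSum (H c k) cs) (allFin d)) cs
    colouringSum-alt H [] = refl
    colouringSum-alt H (c ∷ cs) = begin
      Σ (λ k → colouringSum (λ ps → H c k ps - alt (λ ck ps → H′ k ck ps) ps) cs) (allFin d)
        ≈⟨ Σ-cong (λ k → trans (colouringSum-sub _ _ cs) (+-congˡ (-‿cong (colouringSum-alt (λ c′ k′ ps → H′ k (c′ , k′) ps) cs)))) (allFin d) ⟩
      Σ (λ k → colouringSum (H c k) cs - alt (λ c′ cs → Σ (λ k′ → colouringSum (H′ k (c′ , k′)) cs) (allFin d)) cs) (allFin d)
        ≈⟨ trans (Σ-+ _ _ (allFin d)) (+-congˡ (Σ-neg _ (allFin d))) ⟩
      Σ (λ k → colouringSum (H c k) cs) (allFin d) - Σ (λ k → alt (λ c′ cs → Σ (λ k′ → colouringSum (H′ k (c′ , k′)) cs) (allFin d)) cs) (allFin d)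
        ≈⟨ +-congˡ (-‿cong (trans (sym (alt-Σ _ (allFin d) cs)) (alt-cong (λ c′ cs → Σ-swap _ (allFin d) (allFin d)) cs))) ⟩
      Σ (λ k → colouringSum (H c k) cs) (allFin d) - alt (λ c′ cs → Σ (λ k′ → Σ (λ k → colouringSum (H′ k (c′ , k′)) cs) (allFin d)) (allFin d)) cs ∎
      where
      H′ : Fin d → C × Fin d → List (C × Fin d) → K
      H′ k ck ps = H (proj₁ ck) (proj₂ ck) ((c , k) ∷ ps)

  Σ-allFin-indicator : ∀ {d} (k : Fin d) (F : Fin d → K) → Σ (λ j → if ⌊ k Fin.≟ j ⌋ then F j else 0#) (allFin d) ≈ F k
  Σ-allFin-indicator = ∑-indicator

  -- Every monomial of the determinant pairs each column with one row, hence occurs for exactly one colouring.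
  det-colouringSum : ∀ {A C : Set} {d} (x : A → C → K) (κ : A → Fin d) σ cs →
    colouringSum (det (map (Coloured.colouredRow (λ a → x a ∘ proj₁) κ proj₂) σ)) cs ≈ det (map x σ) cs
  det-colouringSum x κ [] [] = refl
  det-colouringSum {d = d} x κ [] (c ∷ cs) = trans (Σ-cong (λ k → colouringSum-0 cs) (allFin d)) (Σ-0 (allFin d))
  det-colouringSum {d = d} x κ (a ∷ σ) cs = trans (colouringSum-alt H cs) (alt-cong inner cs)
    where
    D = det (map (Coloured.colouredRow (λ a → x a ∘ proj₁) κ proj₂) σ)
    H = λ c k ps → (if ⌊ k Fin.≟ κ a ⌋ then x a c else 0#) * D ps
    inner : ∀ c cs → Σ (λ k → colouringSum (H c k) cs) (allFin d) ≈ x a c * det (map x σ) cs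
    inner c cs = begin
      Σ (λ k → colouringSum (H c k) cs) (allFin d)
        ≈⟨ Σ-cong (λ k → trans (colouringSum-*ˡ _ D cs) (*-congˡ (det-colouringSum x κ σ cs))) (allFin d) ⟩
      Σ (λ k → (if ⌊ k Fin.≟ κ a ⌋ then x a c else 0#) * det (map x σ) cs) (allFin d)
        ≈⟨ Σ-*ʳ _ _ (allFin d) ⟩
      Σ (λ k → if ⌊ k Fin.≟ κ a ⌋ then x a c else 0#) (allFin d) * det (map x σ) cs
        ≈⟨ *-congʳ (trans (Σ-cong flip (allFin d)) (Σ-allFin-indicator (κ a) (λ _ → x a c))) ⟩
      x a c * det (map x σ) cs ∎
      where
      flip : ∀ k → (if ⌊ k Fin.≟ κ a ⌋ then x a c else 0#) ≈ (if ⌊ κ a Fin.≟ k ⌋ then x a c else 0#)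
      flip k with k Fin.≟ κ a | κ a Fin.≟ k
      ... | yes _ | yes _ = refl
      ... | no _ | no _ = refl
      ... | yes e | no n = contradiction (≡.sym e) n
      ... | no n | yes e = contradiction (≡.sym e) n

  if-∧ : ∀ a b y → (if a ∧ b then y else 0#) ≈ (if a then (if b then y else 0#) else 0#)
  if-∧ true b y = refl
  if-∧ false b y = refl

  Σ-if : ∀ {a} {A : Set a} b (F : A → K) xs → Σ (λ x → if b then F x else 0#) xs ≈ (if b then Σ F xs else 0#)
  Σ-if true F xs = refl
  Σ-if false F xs = Σ-0 xs

  if-cong : ∀ b {x y} → x ≈ y → (if b then x else 0#) ≈ (if b then y else 0#)
  if-cong true e = e
  if-cong false e = refl

  Σ-allFin-suc : ∀ {d} (F : Fin (ℕ.suc d) → K) → Σ F (allFin (ℕ.suc d)) ≈ F zero + Σ (F ∘ suc) (allFin d)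
  Σ-allFin-suc F = reflexive (∑-suc F)

  Σ-allVecs : ∀ {A : Set} {k} (F : Vec A (ℕ.suc k) → K) (xs : List A) →
    Σ F (allVecs (ℕ.suc k) xs) ≈ Σ (λ x → Σ (λ v → F (x V.∷ v)) (allVecs k xs)) xs
  Σ-allVecs {k = k} F xs = trans (Σ-concatMap F _ xs) (Σ-cong (λ x → Σ-map F (x V.∷_) (allVecs k xs)) xs)

  -- Sums over words

  module _ {B : Set} {n : ℕ} where

    -- The cells of `σ`, in reading order, are filled independently; every condition on the filling
    -- is left to the summand.
    wordSum : (List (B × Fin n) → K) → List B → K
    wordSum F [] = F []
    wordSum F (b ∷ σ) = Σ (λ x → wordSum (λ e → F ((b , x) ∷ e)) σ) (allFin n)

    wordSum-cong : ∀ {F G : List (B × Fin n) → K} → (∀ e → F e ≈ G e) → ∀ σ → wordSum F σ ≈ wordSum G σ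
    wordSum-cong e [] = e []
    wordSum-cong e (b ∷ σ) = Σ-cong (λ x → wordSum-cong (λ es → e _) σ) (allFin n)

    wordSum-0 : ∀ σ → wordSum (λ _ → 0#) σ ≈ 0#
    wordSum-0 [] = refl
    wordSum-0 (b ∷ σ) = trans (Σ-cong (λ x → wordSum-0 σ) (allFin n)) (Σ-0 (allFin n))

    -- The factor `M` sees only the cells, which are the same for all fillings.
    wordSum-*ʳ : ∀ F (M : List B → K) σ → wordSum (λ e → F e * M (map proj₁ e)) σ ≈ wordSum F σ * M σ
    wordSum-*ʳ F M [] = refl
    wordSum-*ʳ F M (b ∷ σ) = trans (Σ-cong (λ x → wordSum-*ʳ _ (M ∘ (b ∷_)) σ) (allFin n)) (Σ-*ʳ _ _ (allFin n))

    wordSum-*ˡ : ∀ x F σ → wordSum (λ e → x * F e) σ ≈ x * wordSum F σ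
    wordSum-*ˡ x F [] = refl
    wordSum-*ˡ x F (b ∷ σ) = trans (Σ-cong (λ y → wordSum-*ˡ x _ σ) (allFin n)) (Σ-*ˡ x _ (allFin n))

    wordSum-++ : ∀ F σ τ → wordSum F (σ ++ τ) ≈ wordSum (λ e → wordSum (λ e′ → F (e ++ e′)) τ) σ
    wordSum-++ F [] τ = refl
    wordSum-++ F (b ∷ σ) τ = Σ-cong (λ x → wordSum-++ _ σ τ) (allFin n)

    wordSum-Σ : ∀ {a} {A : Set a} (F : A → List (B × Fin n) → K) xs σ →
      wordSum (λ e → Σ (λ x → F x e) xs) σ ≈ Σ (λ x → wordSum (F x) σ) xs
    wordSum-Σ F xs [] = refl
    wordSum-Σ F xs (b ∷ σ) = trans (Σ-cong (λ y → wordSum-Σ _ xs σ) (allFin n)) (Σ-swap _ (allFin n) xs)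

  -- Of all the words whose letters of each colour, read in order, exhaust the columns of that colour, there is only one.
  module Words {B : Set} {n d} (κ : B → Fin d) (f : Fin n → Fin d) where

    matches : List (B × Fin n) → List (Fin n) → Fin d → Bool
    matches e cs j = ⌊ LP.≡-dec Fin._≟_ (map proj₂ (ofColour (κ ∘ proj₁) j e)) (ofColour f j cs) ⌋

    allMatch : List (B × Fin n) → List (Fin n) → Bool
    allMatch e cs = allᵇ (matches e cs) (allFin d)

    signedWord : List (Fin n) → List (B × Fin n) → K
    signedWord cs e = if allMatch e cs then sgn (inv (map proj₂ e)) else 0#

    -- A matching word is a rearrangement of `cs`, since the two agree colour by colour.
    countᵇ-match : ∀ p e cs → allMatch e cs ≡ true → countᵇ p (map proj₂ e) ≡ countᵇ p cs
    countᵇ-match p e cs m = ≡.trans (≡.trans (countᵇ-map p proj₂ e) (countᵇ-by-colour (κ ∘ proj₁) (p ∘ proj₂) e))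
      (≡.trans (∑ℕ-cong λ j → ≡.trans (≡.sym (countᵇ-map p proj₂ (ofColour (κ ∘ proj₁) j e))) (≡.cong (countᵇ p) (columns j)))
        (≡.sym (countᵇ-by-colour f p cs)))
      where
      columns : ∀ j → map proj₂ (ofColour (κ ∘ proj₁) j e) ≡ ofColour f j cs
      columns j with LP.≡-dec Fin._≟_ (map proj₂ (ofColour (κ ∘ proj₁) j e)) (ofColour f j cs) | allᵇ-elim (matches e cs) m (∈-allFin j)
      ... | yes eq | _ = eq

    module _ (b : B) {x : Fin n} (e : List (B × Fin n)) (pre : List (Fin n)) (c : Fin n) (post : List (Fin n)) (fc≡κb : f c ≡ κ b) (none : ofColour f (κ b) pre ≡ []) where

      private
        first-column : ofColour f (κ b) (pre ++ c ∷ post) ≡ c ∷ ofColour f (κ b) post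
        first-column = ≡.trans (LP.filter-++ _ pre (c ∷ post)) (≡.cong₂ _++_ none (ofColour-≡ f c post fc≡κb))
        first-column′ : ofColour f (κ b) (pre ++ post) ≡ ofColour f (κ b) post
        first-column′ = ≡.trans (LP.filter-++ _ pre post) (≡.cong (_++ ofColour f (κ b) post) none)
        first-letters : map proj₂ (ofColour (κ ∘ proj₁) (κ b) ((b , x) ∷ e)) ≡ x ∷ map proj₂ (ofColour (κ ∘ proj₁) (κ b) e)
        first-letters = ≡.cong (map proj₂) (ofColour-≡ (κ ∘ proj₁) (b , x) e ≡.refl)

      -- By `none`, `c` is the first column of the colour of `b`, hence the only letter that can
      -- stand in the first cell of that colour.
      allMatch-≢ : x ≢ c → allMatch ((b , x) ∷ e) (pre ++ c ∷ post) ≡ false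
      allMatch-≢ x≢c with allMatch ((b , x) ∷ e) (pre ++ c ∷ post) in m
      ... | false = ≡.refl
      ... | true with LP.≡-dec Fin._≟_ (map proj₂ (ofColour (κ ∘ proj₁) (κ b) ((b , x) ∷ e))) (ofColour f (κ b) (pre ++ c ∷ post))
                   | allᵇ-elim (matches ((b , x) ∷ e) (pre ++ c ∷ post)) m (∈-allFin (κ b))
      ...   | yes eq | _ = contradiction (LP.∷-injectiveˡ (≡.trans (≡.sym first-letters) (≡.trans eq first-column))) x≢c

      allMatch-≡ : x ≡ c → allMatch ((b , x) ∷ e) (pre ++ c ∷ post) ≡ allMatch e (pre ++ post)
      allMatch-≡ x≡c = allᵇ-cong same (allFin d)
        where
        same : ∀ j → matches ((b , x) ∷ e) (pre ++ c ∷ post) j ≡ matches e (pre ++ post) j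
        same j with κ b Fin.≟ j
        ... | yes ≡.refl = ⌊⌋-⇔
                (λ eq → ≡.trans (LP.∷-injectiveʳ (≡.trans eq first-column)) (≡.sym first-column′))
                (λ eq → ≡.trans (≡.cong₂ _∷_ x≡c (≡.trans eq first-column′)) (≡.sym first-column))
              (LP.≡-dec Fin._≟_ _ _) (LP.≡-dec Fin._≟_ _ _)
        ... | no κb≢j = ≡.cong (λ z → ⌊ LP.≡-dec Fin._≟_ (map proj₂ (ofColour (κ ∘ proj₁) j e)) z ⌋)
                (ofColour-split κ f pre c post (λ fc≡j → κb≢j (≡.trans (≡.sym fc≡κb) fc≡j)))

    countᵇ-below : ∀ pre c post → AllPairs Fin._<_ (pre ++ c ∷ post) → countᵇ (below c) (pre ++ post) ≡ length pre
    countᵇ-below pre c post sorted with AllPairs-delete pre sorted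
    ... | pre< , post> , _ = ≡.trans (countᵇ-++ (below c) pre post)
      (≡.trans (≡.cong₂ ℕ._+_
        (countᵇ-all (below c) (All.map (λ {y} y<c → ≡ᵗ (ℕP.<⇒<ᵇ y<c)) pre<))
        (countᵇ-none (below c) (All.map (λ {y} y>c → not-below y>c) post>))) (ℕP.+-identityʳ _))
      where
      ≡ᵗ : ∀ {b} → T b → b ≡ true
      ≡ᵗ {true} _ = ≡.refl
      not-below : ∀ {y : Fin n} → c Fin.< y → below c y ≡ false
      not-below {y} c<y with below c y in eq
      ... | false = ≡.refl
      ... | true = contradiction (ℕP.<ᵇ⇒< (toℕ y) (toℕ c) (≡.subst T (≡.sym eq) tt)) (ℕP.<-asym c<y)

    -- Only the first column `c` of the colour of `b` can be the first letter. As `cs` is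
    -- increasing, it forms `length pre` inversions with the later letters, which is the sign on the
    -- left of `sgn-peel`. Its position within its own colour is 0, so the last factor there is
    -- trivial.
    wordSum-signedWord : ∀ σ cs → AllPairs Fin._<_ cs → SameColours κ σ f cs →
      wordSum (signedWord cs) σ ≈ sgn (inv (map κ σ)) * sgn (inv (map f cs))
    wordSum-signedWord [] [] _ _ = trans
      (reflexive (≡.cong (if_then 1# else 0#) (allᵇ-intro (matches [] []) (λ _ → ≡.refl) (allFin d))))
      (sym (*-identityˡ 1#))
    wordSum-signedWord [] (c ∷ cs) _ same with () ← ≡.trans (same (f c)) (≡.cong length (ofColour-≡ f c cs ≡.refl))
    wordSum-signedWord (b ∷ σ) cs sorted same
      with first-of-colour f (κ b) cs (λ z → 1+n≢0 (≡.trans (≡.cong length (≡.sym (ofColour-≡ κ b σ ≡.refl))) (≡.trans (same (κ b)) z)))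
      where
      1+n≢0 : ∀ {n} → ℕ.suc n ≢ 0
      1+n≢0 ()
    ... | pre , c , post , ≡.refl , fc≡κb , none = begin
      Σ (λ x → wordSum (λ e → signedWord cs′ ((b , x) ∷ e)) σ) (allFin n)
        ≈⟨ Σ-cong first-letter (allFin n) ⟩
      Σ (λ x → if ⌊ c Fin.≟ x ⌋ then sgn (length pre) * (s * t) else 0#) (allFin n)
        ≈⟨ Σ-allFin-indicator c (λ _ → sgn (length pre) * (s * t)) ⟩
      sgn (length pre) * (s * t)
        ≈⟨ *-assoc _ s t ⟨
      sgn (length pre) * s * t
        ≈⟨ sgn-peel κ f b σ pre c post fc≡κb same′ ⟩
      sgn (inv (map κ (b ∷ σ))) * sgn (inv (map f cs′)) * sgn (length (ofColour f (κ b) pre))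
        ≡⟨ ≡.cong (λ z → sgn (inv (map κ (b ∷ σ))) * sgn (inv (map f cs′)) * sgn (length z)) none ⟩
      sgn (inv (map κ (b ∷ σ))) * sgn (inv (map f cs′)) * 1#
        ≈⟨ *-identityʳ _ ⟩
      sgn (inv (map κ (b ∷ σ))) * sgn (inv (map f cs′)) ∎
      where
      cs′ = pre ++ c ∷ post
      s = sgn (inv (map κ σ))
      t = sgn (inv (map f (pre ++ post)))
      same′ : SameColours κ σ f (pre ++ post)
      same′ j with κ b Fin.≟ j
      ... | no κb≢j = ≡.trans (≡.cong length (≡.sym (ofColour-≢ κ b σ κb≢j)))
              (≡.trans (same j) (≡.cong length (ofColour-split κ f pre c post (λ fc≡j → κb≢j (≡.trans (≡.sym fc≡κb) fc≡j)))))
      ... | yes ≡.refl = ℕP.suc-injective (≡.trans (≡.cong length (≡.sym (ofColour-≡ κ b σ ≡.refl)))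
              (≡.trans (same (κ b)) (≡.trans (≡.cong length (≡.trans (LP.filter-++ _ pre (c ∷ post)) (≡.cong₂ _++_ none (ofColour-≡ f c post fc≡κb))))
                (≡.cong (ℕ.suc ∘ length) (≡.sym (≡.trans (LP.filter-++ _ pre post) (≡.cong (_++ ofColour f (κ b) post) none)))))))
      letter : ∀ e → signedWord cs′ ((b , c) ∷ e) ≈ sgn (length pre) * signedWord (pre ++ post) e
      letter e rewrite allMatch-≡ b e pre c post fc≡κb none ≡.refl with allMatch e (pre ++ post) in m
      ... | false = sym (zeroʳ _)
      ... | true = trans (reflexive (≡.cong (λ z → sgn (z ℕ.+ inv (map proj₂ e)))
                (≡.trans (countᵇ-match (below c) e (pre ++ post) m) (countᵇ-below pre c post sorted))))
              (sgn-+ (length pre) _)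
      first-letter : ∀ x → wordSum (λ e → signedWord cs′ ((b , x) ∷ e)) σ ≈ (if ⌊ c Fin.≟ x ⌋ then sgn (length pre) * (s * t) else 0#)
      first-letter x with c Fin.≟ x
      ... | no c≢x = trans (wordSum-cong (λ e → reflexive (≡.cong (if_then sgn (inv (x ∷ map proj₂ e)) else 0#)
              (allMatch-≢ b e pre c post fc≡κb none (c≢x ∘ ≡.sym)))) σ) (wordSum-0 σ)
      ... | yes ≡.refl = trans (wordSum-cong letter σ) (trans (wordSum-*ˡ (sgn (length pre)) _ σ)
              (*-congˡ (wordSum-signedWord σ (pre ++ post) (proj₂ (proj₂ (AllPairs-delete pre sorted))) same′)))

  -- Sums over tableau shapes

  module _ {A : Set} (top : A → Bool) (d n : ℕ) where

    -- `F` receives the cells of a shape in reading order. The column sizes are unconstrained;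
    -- unsuitable shapes will contribute zero.
    shapeSum : (List (A × Fin d) → K) → List A → K
    shapeSum F [] = F []
    shapeSum F (ρ ∷ ρs) = if top ρ
      then shapeSum (λ σ → F (map (ρ ,_) (allFin d) ++ σ)) ρs
      else Σ (λ k → shapeSum (λ σ → F ((ρ , k) ∷ σ)) ρs) (allFin d)

    shapeSum-cong : ∀ {F G : List (A × Fin d) → K} → (∀ σ → F σ ≈ G σ) → ∀ ρs → shapeSum F ρs ≈ shapeSum G ρs
    shapeSum-cong e [] = e []
    shapeSum-cong e (ρ ∷ ρs) with top ρ
    ... | true = shapeSum-cong (λ σ → e _) ρs
    ... | false = Σ-cong (λ k → shapeSum-cong (λ σ → e _) ρs) (allFin d)

    wordSum-shapeSum : ∀ {B : Set} (H : List (B × Fin n) → List (A × Fin d) → K) τ ρs →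
      wordSum (λ e → shapeSum (H e) ρs) τ ≈ shapeSum (λ σ → wordSum (λ e → H e σ) τ) ρs
    wordSum-shapeSum H τ [] = refl
    wordSum-shapeSum H τ (ρ ∷ ρs) with top ρ
    ... | true = wordSum-shapeSum _ τ ρs
    ... | false = trans (wordSum-Σ _ (allFin d) τ) (Σ-cong (λ k → wordSum-shapeSum _ τ ρs) (allFin d))

    -- Unfolds to the row test of `isJelly` when `top ρ` is `toℕ ρ <ᵇ r`.
    rowOk : ∀ {e} → A → Vec (Maybe (Fin n)) e → Bool
    rowOk ρ row = if top ρ then allᵇ is-just (V.toList row) else (countᵇ is-just (V.toList row) ℕ.≡ᵇ 1)

    private
      Cells : Set
      Cells = List ((A × Fin d) × Fin n)

      Σ-row : ∀ {e} (F : Vec (Maybe (Fin n)) (ℕ.suc e) → K) → Σ F (allVecs (ℕ.suc e) (cells n))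
        ≈ Σ (λ row → F (nothing V.∷ row)) (allVecs e (cells n)) + Σ (λ x → Σ (λ row → F (just x V.∷ row)) (allVecs e (cells n))) (allFin n)
      Σ-row {e} F = trans (Σ-allVecs F (cells n)) (+-congˡ (Σ-map _ just (allFin n)))

    fullRow-sum : ∀ {e} (G : Cells → K) ρ (h : Fin e → Fin d) →
      Σ (λ row → if allᵇ is-just (V.toList row) then G (flatRow ρ h row) else 0#) (allVecs e (cells n))
      ≈ wordSum G (map (ρ ,_) (tabulate h))
    fullRow-sum {ℕ.zero} G ρ h = +-identityʳ _
    fullRow-sum {ℕ.suc e} G ρ h = trans (Σ-row (λ row → if allᵇ is-just (V.toList row) then G (flatRow ρ h row) else 0#)) (trans (+-cong (Σ-0 (allVecs e (cells n)))
      (Σ-cong (λ x → fullRow-sum (λ es → G (((ρ , h zero) , x) ∷ es)) ρ (h ∘ suc)) (allFin n))) (+-identityˡ _))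

    -- Handles the rest of a singleton row after its only filled cell.
    emptyRow-sum : ∀ {e} (G : Cells → K) ρ (h : Fin e → Fin d) →
      Σ (λ row → if countᵇ is-just (V.toList row) ℕ.≡ᵇ 0 then G (flatRow ρ h row) else 0#) (allVecs e (cells n)) ≈ G []
    emptyRow-sum {ℕ.zero} G ρ h = +-identityʳ _
    emptyRow-sum {ℕ.suc e} G ρ h = trans (Σ-row (λ row → if countᵇ is-just (V.toList row) ℕ.≡ᵇ 0 then G (flatRow ρ h row) else 0#)) (trans (+-cong (emptyRow-sum G ρ (h ∘ suc))
      (trans (Σ-cong (λ x → Σ-0 (allVecs e (cells n))) (allFin n)) (Σ-0 (allFin n)))) (+-identityʳ _))

    singletonRow-sum : ∀ {e} (G : Cells → K) ρ (h : Fin e → Fin d) →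
      Σ (λ row → if countᵇ is-just (V.toList row) ℕ.≡ᵇ 1 then G (flatRow ρ h row) else 0#) (allVecs e (cells n))
      ≈ Σ (λ k → wordSum G [ (ρ , h k) ]) (allFin e)
    singletonRow-sum {ℕ.zero} G ρ h = +-identityʳ _
    singletonRow-sum {ℕ.suc e} G ρ h = trans (Σ-row (λ row → if countᵇ is-just (V.toList row) ℕ.≡ᵇ 1 then G (flatRow ρ h row) else 0#)) (trans (+-cong (singletonRow-sum G ρ (h ∘ suc))
      (Σ-cong (λ x → emptyRow-sum (λ es → G (((ρ , h zero) , x) ∷ es)) ρ (h ∘ suc)) (allFin n)))
      (trans (+-comm _ _) (sym (Σ-allFin-suc (λ k → wordSum G [ (ρ , h k) ])))))

    -- The row condition is a conjunction over the rows, so the arrays can be summed row by row. The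
    -- column condition is part of `F`.
    tableauSum : ∀ {m} (F : Cells → K) (l : Fin m → A) →
      Σ (λ T → if allᵇ (λ i → rowOk (l i) (V.lookup T i)) (allFin m) then F (flatten l T) else 0#) (allVecs m (allVecs d (cells n)))
      ≈ shapeSum (wordSum F) (tabulate l)
    tableauSum {ℕ.zero} F l = +-identityʳ _
    tableauSum {ℕ.suc m} F l = begin
      Σ _ (allVecs (ℕ.suc m) (allVecs d (cells n)))
        ≈⟨ Σ-allVecs _ (allVecs d (cells n)) ⟩
      Σ (λ row → Σ (λ T → if allᵇ (λ i → rowOk (l i) (V.lookup (row V.∷ T) i)) (allFin (ℕ.suc m)) then F (flatRow (l zero) id row ++ flatten l′ T) else 0#) Ts) (allVecs d (cells n))
        ≈⟨ Σ-cong split-row (allVecs d (cells n)) ⟩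
      Σ (λ row → if rowOk (l zero) row then G (flatRow (l zero) id row) else 0#) (allVecs d (cells n))
        ≈⟨ first-row ⟩
      shapeSum (wordSum F) (tabulate l) ∎
      where
      l′ = l ∘ suc
      Ts = allVecs m (allVecs d (cells n))
      H : Cells → List (A × Fin d) → K
      H es = wordSum (λ es′ → F (es ++ es′))
      G : Cells → K
      G es = shapeSum (H es) (tabulate l′)
      split-row : ∀ row → Σ (λ T → if allᵇ (λ i → rowOk (l i) (V.lookup (row V.∷ T) i)) (allFin (ℕ.suc m)) then F (flatRow (l zero) id row ++ flatten l′ T) else 0#) Ts
        ≈ (if rowOk (l zero) row then G (flatRow (l zero) id row) else 0#)
      split-row row = begin
        _ ≈⟨ Σ-cong (λ T → trans (reflexive (≡.cong (if_then F (flatRow (l zero) id row ++ flatten l′ T) else 0#)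
                       (allᵇ-suc (λ i → rowOk (l i) (V.lookup (row V.∷ T) i)))))
                     (if-∧ (rowOk (l zero) row) _ _)) Ts ⟩
        _ ≈⟨ Σ-if (rowOk (l zero) row) _ Ts ⟩
        _ ≈⟨ if-cong (rowOk (l zero) row) (tableauSum (λ es → F (flatRow (l zero) id row ++ es)) l′) ⟩
        _ ∎
      first-row : Σ (λ row → if rowOk (l zero) row then G (flatRow (l zero) id row) else 0#) (allVecs d (cells n))
        ≈ shapeSum (wordSum F) (tabulate l)
      first-row with top (l zero)
      ... | true = trans (fullRow-sum G (l zero) id) (trans (wordSum-shapeSum H (map (l zero ,_) (allFin d)) (tabulate l′))
              (shapeSum-cong (λ σ → sym (wordSum-++ F (map (l zero ,_) (allFin d)) σ)) (tabulate l′)))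
      ... | false = trans (singletonRow-sum G (l zero) id)
              (Σ-cong (λ k → wordSum-shapeSum H [ (l zero , k) ] (tabulate l′)) (allFin d))

  Σ-filter : ∀ {a p} {A : Set a} {P : A → Set p} (P? : ∀ x → Dec (P x)) {F G : A → K} →
    (∀ x → P x → G x ≈ F x) → (∀ x → ¬ P x → G x ≈ 0#) → ∀ xs → Σ G xs ≈ Σ F (filter P? xs)
  Σ-filter P? e z [] = refl
  Σ-filter P? e z (x ∷ xs) with P? x
  ... | yes px = +-cong (e x px) (Σ-filter P? e z xs)
  ... | no ¬px = trans (+-cong (z x ¬px) (Σ-filter P? e z xs)) (+-identityˡ _)

  colouringSum-tabulate : ∀ {C : Set} {d m} (F : List (C × Fin d) → K) (l : Fin m → C) →
    colouringSum F (tabulate l) ≈ Σ (λ v → F (tabulate (λ i → l i , V.lookup v i))) (allVecs m (allFin d))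
  colouringSum-tabulate {m = ℕ.zero} F l = sym (+-identityʳ _)
  colouringSum-tabulate {d = d} {m = ℕ.suc m} F l = trans
    (Σ-cong (λ k → colouringSum-tabulate (λ ps → F ((l zero , k) ∷ ps)) (l ∘ suc)) (allFin d))
    (sym (Σ-allVecs (λ v → F (tabulate (λ i → l i , V.lookup v i))) (allFin d)))

  -- The determinant with restricted and full rows

  module Mixed {A : Set} (top : A → Bool) {n d} (x : A → Fin n → K) (f : Fin n → Fin (ℕ.suc d)) where

    D : ℕ
    D = ℕ.suc d

    restrict : Fin D → (Fin n → K) → Fin n → K
    restrict k y c = if ⌊ f c Fin.≟ k ⌋ then y c else 0#

    mixedRows : List A → List (Fin n → K)
    mixedRows [] = []
    mixedRows (ρ ∷ ρs) = (if top ρ then map (λ k → restrict k (x ρ)) (allFin D) else [ x ρ ]) ++ mixedRows ρs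

    open Coloured {A = A × Fin D} (x ∘ proj₁) proj₂ f using (colouredRow; block; ∏-block-mismatch; det-coloured)
    open Words {B = A × Fin D} proj₂ f using (signedWord; wordSum-signedWord)

    row≈Σ-restrict : ∀ (y : Fin n → K) c → y c ≈ Σ (λ k → restrict k y c) (allFin D)
    row≈Σ-restrict y c = sym (Σ-allFin-indicator (f c) (λ _ → y c))

    -- The rows already treated are kept in `pre`, because linearity is applied to a row in the
    -- middle of the determinant.
    shapeSum-det : ∀ pre ρs cs →
      shapeSum top D n (λ σ → det (pre ++ map colouredRow σ) cs) ρs ≈ det (pre ++ mixedRows ρs) cs
    shapeSum-det pre [] cs = refl
    shapeSum-det pre (ρ ∷ ρs) cs with top ρ
    ... | true = trans (shapeSum-cong top D n (λ σ → reflexive (≡.cong (λ z → det z cs) (regroup σ))) ρs)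
                   (trans (shapeSum-det (pre ++ Y) ρs cs) (reflexive (≡.cong (λ z → det z cs) (LP.++-assoc pre Y (mixedRows ρs)))))
      where
      Y = map (λ k → restrict k (x ρ)) (allFin D)
      regroup : ∀ σ → pre ++ map colouredRow (map (ρ ,_) (allFin D) ++ σ) ≡ (pre ++ Y) ++ map colouredRow σ
      regroup σ = ≡.trans (≡.cong (pre ++_) (≡.trans (LP.map-++ colouredRow (map (ρ ,_) (allFin D)) σ)
        (≡.cong (_++ map colouredRow σ) (≡.sym (LP.map-∘ (allFin D)))))) (≡.sym (LP.++-assoc pre Y _))
    ... | false = begin
      Σ (λ k → shapeSum top D n (λ σ → det (pre ++ restrict k (x ρ) ∷ map colouredRow σ) cs) ρs) (allFin D)
        ≈⟨ Σ-cong (λ k → trans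
             (shapeSum-cong top D n (λ σ → reflexive (≡.cong (λ z → det z cs) (≡.sym (LP.++-assoc pre [ restrict k (x ρ) ] _)))) ρs)
             (trans (shapeSum-det (pre ++ [ restrict k (x ρ) ]) ρs cs)
               (reflexive (≡.cong (λ z → det z cs) (LP.++-assoc pre [ restrict k (x ρ) ] _))))) (allFin D) ⟩
      Σ (λ k → det (pre ++ restrict k (x ρ) ∷ mixedRows ρs) cs) (allFin D)
        ≈⟨ det-Σ-row pre (λ k → restrict k (x ρ)) (allFin D) (mixedRows ρs) cs ⟨
      det (pre ++ (λ c → Σ (λ k → restrict k (x ρ) c) (allFin D)) ∷ mixedRows ρs) cs
        ≈⟨ det-congʳ pre (alt-cong (λ c cs → *-congʳ (row≈Σ-restrict (x ρ) c))) cs ⟨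
      det (pre ++ x ρ ∷ mixedRows ρs) cs ∎

    jellyTerm : List (Fin n) → List ((A × Fin D) × Fin n) → K
    jellyTerm cs e = signedWord cs e * ∏ (block (map proj₁ e) cs)

    -- The minors depend only on the shape, so just the signs are summed over the fillings. If the
    -- column sizes are wrong, `wordSum-signedWord` does not apply, but both sides vanish.
    wordSum-jellyTerm : ∀ cs → AllPairs Fin._<_ cs → ∀ σ → wordSum (jellyTerm cs) σ ≈ det (map colouredRow σ) cs
    wordSum-jellyTerm cs sorted σ = begin
      wordSum (jellyTerm cs) σ
        ≈⟨ wordSum-*ʳ (signedWord cs) (λ τ → ∏ (block τ cs)) σ ⟩
      wordSum (signedWord cs) σ * ∏ (block σ cs)
        ≈⟨ signs (SameColours? proj₂ f σ cs) ⟩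
      sgn (inv (map proj₂ σ)) * sgn (inv (map f cs)) * ∏ (block σ cs)
        ≈⟨ *-assoc _ _ _ ⟩
      sgn (inv (map proj₂ σ)) * (sgn (inv (map f cs)) * ∏ (block σ cs))
        ≈⟨ det-coloured σ cs ⟨
      det (map colouredRow σ) cs ∎
      where
      signs : Dec (SameColours proj₂ σ f cs) →
        wordSum (signedWord cs) σ * ∏ (block σ cs) ≈ sgn (inv (map proj₂ σ)) * sgn (inv (map f cs)) * ∏ (block σ cs)
      signs (yes same) = *-congʳ (wordSum-signedWord σ cs sorted same)
      signs (no ¬same) = trans (trans (*-congˡ vanishes) (zeroʳ _)) (sym (trans (*-congˡ vanishes) (zeroʳ _)))
        where vanishes = ∏-block-mismatch σ cs ¬same

    tableauSum-det : ∀ {m} (l : Fin m → A) cs → AllPairs Fin._<_ cs →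
      Σ (λ T → if allᵇ (λ i → rowOk top D n (l i) (V.lookup T i)) (allFin m) then jellyTerm cs (flatten l T) else 0#)
        (allVecs m (allVecs D (cells n)))
      ≈ det (mixedRows (tabulate l)) cs
    tableauSum-det l cs sorted = trans (tableauSum top D n (jellyTerm cs) l)
      (trans (shapeSum-cong top D n (wordSum-jellyTerm cs sorted) (tabulate l)) (shapeSum-det [] (tabulate l) cs))

    -- Adding to the top row of colour zero the same row of every other colour makes it a full row, which is then
    -- grouped with the other full rows.

    labels : List A → List (A × Fin D)
    labels [] = []
    labels (ρ ∷ ρs) = (if top ρ then map (ρ ,_) (allFin D) else [ (ρ , zero) ]) ++ labels ρs

    fullOrRestricted : A × Fin D → Fin n → K
    fullOrRestricted (ρ , zero) = x ρ
    fullOrRestricted (ρ , suc k) = restrict (suc k) (x ρ)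

    det-complete-rows : ∀ ρs cs → det (mixedRows ρs) cs ≈ det (map fullOrRestricted (labels ρs)) cs
    det-complete-rows [] cs = refl
    det-complete-rows (ρ ∷ ρs) cs with top ρ
    ... | false = det-congʳ [ x ρ ] {mixedRows ρs} {map fullOrRestricted (labels ρs)} (det-complete-rows ρs) cs
    ... | true = begin
      det (restrict zero (x ρ) ∷ map R′ (tabulate suc) ++ mixedRows ρs) cs
        -- The sum over `allFin D` unfolds to its `zero` term plus the sum over `tabulate suc`, the
        -- form that `det-add-rows` requires.
        ≈⟨ det-add-rows R′ (tabulate suc) (row≈Σ-restrict (x ρ)) (mixedRows ρs) cs ⟨
      det (x ρ ∷ map R′ (tabulate suc) ++ mixedRows ρs) cs
        ≈⟨ det-congʳ (x ρ ∷ map R′ (tabulate suc)) {mixedRows ρs} (det-complete-rows ρs) cs ⟩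
      det (x ρ ∷ map R′ (tabulate suc) ++ map fullOrRestricted (labels ρs)) cs
        ≡⟨ ≡.cong (λ z → det (x ρ ∷ z) cs) regroup ⟨
      det (map fullOrRestricted (map (ρ ,_) (allFin D) ++ labels ρs)) cs ∎
      where
      R′ = λ k → restrict k (x ρ)
      regroup : map fullOrRestricted (map (ρ ,_) (tabulate suc) ++ labels ρs)
              ≡ map R′ (tabulate suc) ++ map fullOrRestricted (labels ρs)
      regroup = ≡.trans (LP.map-++ fullOrRestricted (map (ρ ,_) (tabulate suc)) (labels ρs))
        (≡.cong (_++ map fullOrRestricted (labels ρs)) (≡.trans (≡.sym (LP.map-∘ (tabulate suc)))
          (≡.trans (LP.map-tabulate suc _) (≡.sym (LP.map-tabulate suc R′)))))

    -- The row groups of the Laplace expansion; their lengths will be the sizes `shapeSize`.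
    rowsOfColour : Fin D → List A → List A
    rowsOfColour zero ρs = ρs
    rowsOfColour (suc _) ρs = filterᵇ top ρs

    ofColour-labels : ∀ j ρs → ofColour proj₂ j (labels ρs) ≡ map (_, j) (rowsOfColour j ρs)
    ofColour-labels zero [] = ≡.refl
    ofColour-labels (suc j) [] = ≡.refl
    ofColour-labels j (ρ ∷ ρs) with top ρ in topρ
    ofColour-labels j (ρ ∷ ρs) | true = ≡.trans (LP.filter-++ _ (map (ρ ,_) (allFin D)) (labels ρs))
      (≡.trans (≡.cong₂ _++_ (ofColour-row (allFin D) j) (ofColour-labels j ρs)) (≡.trans (≡.cong (λ z → map (ρ ,_) z ++ map (_, j) (rowsOfColour j ρs)) (ofColour-allFin j)) (cons j)))
      where
      ofColour-row : ∀ ks j → ofColour proj₂ j (map (ρ ,_) ks) ≡ map (ρ ,_) (ofColour id j ks)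
      ofColour-row [] j = ≡.refl
      ofColour-row (k ∷ ks) j with k Fin.≟ j
      ... | yes _ = ≡.cong ((ρ , k) ∷_) (ofColour-row ks j)
      ... | no _ = ofColour-row ks j
      cons : ∀ j → (ρ , j) ∷ map (_, j) (rowsOfColour j ρs) ≡ map (_, j) (rowsOfColour j (ρ ∷ ρs))
      cons zero = ≡.refl
      cons (suc j) rewrite topρ = ≡.refl
    ofColour-labels zero (ρ ∷ ρs) | false = ≡.cong ((ρ , zero) ∷_) (ofColour-labels zero ρs)
    ofColour-labels (suc j) (ρ ∷ ρs) | false rewrite topρ = ofColour-labels (suc j) ρs

    -- Group `zero` consists of full rows and accepts every column, whereas group `suc k` consists
    -- of rows supported on the columns with `f c ≡ suc k`.
    Compatible : Vec (Fin D) n → Set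
    Compatible v = ∀ c → V.lookup v c ≡ zero ⊎ f c ≡ V.lookup v c

    SizesAgree : List A → Vec (Fin D) n → Set
    SizesAgree ρs v = ∀ j → length (rowsOfColour j ρs) ≡ length (ofColour (V.lookup v) j (allFin n))

    Good : List A → Vec (Fin D) n → Set
    Good ρs v = Compatible v × SizesAgree ρs v

    compatible? : ∀ v c → Dec (V.lookup v c ≡ zero ⊎ f c ≡ V.lookup v c)
    compatible? v c = (V.lookup v c Fin.≟ zero) ⊎-dec (f c Fin.≟ V.lookup v c)

    sizeAgrees? : ∀ ρs v j → Dec (length (rowsOfColour j ρs) ≡ length (ofColour (V.lookup v) j (allFin n)))
    sizeAgrees? ρs v j = length (rowsOfColour j ρs) ℕ.≟ length (ofColour (V.lookup v) j (allFin n))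

    good? : ∀ ρs v → Dec (Good ρs v)
    good? ρs v = FinP.all? (compatible? v) ×-dec FinP.all? (sizeAgrees? ρs v)

    module _ (ρs : List A) (v : Vec (Fin D) n) where

      private
        g = V.lookup v
        rows : Fin D → List (Fin n → K)
        rows j = map fullOrRestricted (map (_, j) (rowsOfColour j ρs))
        class : Fin D → List (Fin n)
        class j = ofColour g j (allFin n)

      colourBlock : Fin D → K
      colourBlock j = det (rows j) (class j)

      colourMinor : Fin D → K
      colourMinor j = det (map x (rowsOfColour j ρs)) (class j)

      -- On the columns that a compatible colouring assigns to a restricted group, the restriction
      -- changes nothing.
      colourBlock-compatible : Compatible v → ∀ j → colourBlock j ≈ colourMinor j
      colourBlock-compatible compat zero = reflexive (≡.cong (λ z → det z (class zero)) (≡.sym (LP.map-∘ ρs)))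
      colourBlock-compatible compat (suc j) = trans
        (reflexive (≡.cong (λ z → det z (class (suc j))) (≡.sym (LP.map-∘ (filterᵇ top ρs)))))
        (det-rows-cong {P = λ c → f c ≡ suc j} (λ ρ fc≡ → restrict-own (x ρ) fc≡) (filterᵇ top ρs)
          (All.map (λ {c} gc≡ → own c gc≡ (compat c)) (AllP.all-filter (λ c → g c Fin.≟ suc j) (allFin n))))
        where
        own : ∀ c → g c ≡ suc j → g c ≡ zero ⊎ f c ≡ g c → f c ≡ suc j
        own c gc≡ (inj₁ gc≡0) with () ← ≡.trans (≡.sym gc≡0) gc≡
        own c gc≡ (inj₂ fc≡gc) = ≡.trans fc≡gc gc≡
        restrict-own : ∀ y {c} → f c ≡ suc j → restrict (suc j) y c ≈ y c
        restrict-own y {c} fc≡ with f c Fin.≟ suc j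
        ... | yes _ = refl
        ... | no fc≢ = contradiction fc≡ fc≢

      -- All rows of the group that receives `c` vanish on `c`.
      colourBlock-incompatible : ∀ c → ¬ (g c ≡ zero ⊎ f c ≡ g c) → colourBlock (g c) ≈ 0#
      colourBlock-incompatible c bad with g c in gc≡
      ... | zero = contradiction (inj₁ ≡.refl) bad
      ... | suc j = trans
        (reflexive (≡.cong (λ z → det z (class (suc j))) (≡.sym (LP.map-∘ (filterᵇ top ρs)))))
        (det-zero-column {P = λ c → f c ≢ suc j} (λ ρ fc≢ → restrict-other (x ρ) fc≢) (filterᵇ top ρs)
          (Any.map (λ { ≡.refl → bad ∘ inj₂ }) (∈-filter⁺ (λ c → g c Fin.≟ suc j) (∈-allFin c) gc≡)))
        where
        restrict-other : ∀ y {c} → f c ≢ suc j → restrict (suc j) y c ≈ 0#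
        restrict-other y {c} fc≢ with f c Fin.≟ suc j
        ... | yes fc≡ = contradiction fc≡ fc≢
        ... | no _ = refl

      ∏-colourBlock-good : Good ρs v → ∏ colourBlock ≈ ∏ colourMinor
      ∏-colourBlock-good (compat , _) = ∏-cong (colourBlock-compatible compat)

      ∏-colourBlock-vanishes : ∀ j → colourBlock j ≈ 0# → ∏ colourBlock ≈ 0#
      ∏-colourBlock-vanishes j e = trans (∏-except colourBlock j) (trans (*-congʳ e) (zeroˡ _))

      ∏-colourBlock-bad : ¬ Good ρs v → ∏ colourBlock ≈ 0#
      ∏-colourBlock-bad bad with FinP.all? (compatible? v)
      ... | no ¬compat with FinP.¬∀⟶∃¬ n _ (compatible? v) ¬compat
      ...   | c , bad-c = ∏-colourBlock-vanishes (g c) (colourBlock-incompatible c bad-c)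
      ∏-colourBlock-bad bad | yes compat with FinP.¬∀⟶∃¬ D _ (sizeAgrees? ρs v) (λ agree → bad (compat , agree))
      ... | j , ≢ = ∏-colourBlock-vanishes j (det-length (rows j) (class j)
              (≢ ∘ ≡.trans (≡.sym (≡.trans (LP.length-map fullOrRestricted (map (_, j) (rowsOfColour j ρs))) (LP.length-map (_, j) (rowsOfColour j ρs))))))

    colouringSign : List A → Vec (Fin D) n → ℕ
    colouringSign ρs v = inv (map proj₂ (labels ρs)) ℕ.+ inv (map (V.lookup v) (allFin n))

    -- The filter is there because `InFlamingo` admits only generators of the right shape, and
    -- because compatibility is what turns the restricted rows into full ones.
    det-mixedRows : ∀ ρs → det (mixedRows ρs) (allFin n)
      ≈ Σ (λ v → sgn (colouringSign ρs v) * ∏ (colourMinor ρs v)) (filter (good? ρs) (allVecs n (allFin D)))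
    det-mixedRows ρs = begin
      det (mixedRows ρs) (allFin n)
        ≈⟨ det-complete-rows ρs (allFin n) ⟩
      det (map fullOrRestricted (labels ρs)) (allFin n)
        ≈⟨ det-colouringSum fullOrRestricted proj₂ (labels ρs) (allFin n) ⟨
      colouringSum (det (map ĉ (labels ρs))) (allFin n)
        ≈⟨ colouringSum-tabulate (det (map ĉ (labels ρs))) id ⟩
      Σ (λ v → det (map ĉ (labels ρs)) (tabulate (λ i → i , V.lookup v i))) (allVecs n (allFin D))
        ≈⟨ Σ-cong expand (allVecs n (allFin D)) ⟩
      Σ (λ v → sgn (colouringSign ρs v) * ∏ (colourBlock ρs v)) (allVecs n (allFin D))
        ≈⟨ Σ-filter (good? ρs) (λ v good → *-congˡ (∏-colourBlock-good ρs v good))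
             (λ v bad → trans (*-congˡ (∏-colourBlock-bad ρs v bad)) (zeroʳ _)) (allVecs n (allFin D)) ⟩
      Σ (λ v → sgn (colouringSign ρs v) * ∏ (colourMinor ρs v)) (filter (good? ρs) (allVecs n (allFin D))) ∎
      where
      module CR = Coloured {C = Fin n × Fin D} (λ a → fullOrRestricted a ∘ proj₁) proj₂ proj₂
      ĉ = CR.colouredRow
      expand : ∀ v → det (map ĉ (labels ρs)) (tabulate (λ i → i , V.lookup v i)) ≈ sgn (colouringSign ρs v) * ∏ (colourBlock ρs v)
      expand v = begin
        det (map ĉ (labels ρs)) (tabulate h)
          ≡⟨ ≡.cong (det (map ĉ (labels ρs))) (tabulate≡map-allFin h) ⟩
        det (map ĉ (labels ρs)) (map h (allFin n))
          ≈⟨ CR.det-coloured (labels ρs) (map h (allFin n)) ⟩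
        sgn (inv (map proj₂ (labels ρs))) * (sgn (inv (map proj₂ (map h (allFin n)))) * ∏ (CR.block (labels ρs) (map h (allFin n))))
          ≈⟨ *-assoc _ _ _ ⟨
        sgn (inv (map proj₂ (labels ρs))) * sgn (inv (map proj₂ (map h (allFin n)))) * ∏ (CR.block (labels ρs) (map h (allFin n)))
          ≡⟨ ≡.cong (λ z → sgn (inv (map proj₂ (labels ρs))) * sgn (inv z) * ∏ (CR.block (labels ρs) (map h (allFin n)))) (LP.map-∘ (allFin n)) ⟨
        sgn (inv (map proj₂ (labels ρs))) * sgn (inv (map (V.lookup v) (allFin n))) * ∏ (CR.block (labels ρs) (map h (allFin n)))
          ≈⟨ *-cong (sym (sgn-+ (inv (map proj₂ (labels ρs))) _)) (∏-cong blocks) ⟩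
        sgn (colouringSign ρs v) * ∏ (colourBlock ρs v) ∎
        where
        h : Fin n → Fin n × Fin D
        h i = i , V.lookup v i
        ofColour-h : ∀ j cs → ofColour proj₂ j (map h cs) ≡ map h (ofColour (V.lookup v) j cs)
        ofColour-h j [] = ≡.refl
        ofColour-h j (c ∷ cs) with V.lookup v c Fin.≟ j
        ... | yes _ = ≡.cong (h c ∷_) (ofColour-h j cs)
        ... | no _ = ofColour-h j cs
        blocks : ∀ j → CR.block (labels ρs) (map h (allFin n)) j ≈ colourBlock ρs v j
        blocks j = begin
          det (map (λ a → fullOrRestricted a ∘ proj₁) (ofColour proj₂ j (labels ρs))) (ofColour proj₂ j (map h (allFin n)))
            ≡⟨ ≡.cong₂ (λ y z → det (map (λ a → fullOrRestricted a ∘ proj₁) y) z) (ofColour-labels j ρs) (ofColour-h j (allFin n)) ⟩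
          det (map (λ a → fullOrRestricted a ∘ proj₁) (map (_, j) (rowsOfColour j ρs))) (map h (ofColour (V.lookup v) j (allFin n)))
            ≈⟨ det-map h (λ a → fullOrRestricted a ∘ proj₁) (map (_, j) (rowsOfColour j ρs)) _ ⟩
          colourBlock ρs v j ∎

-- The local function go of minor cannot be named. It is recovered by unification with its occurrence in an unfolded
-- minor, after abstracting its arguments to variables.
mutual
  minorFrom : ∀ {n} → Fin n → List (Fin n) → List (Fin n) → ℕ → List (Fin n) → List (Fin n) → Poly n
  minorFrom = _

  minor-unfold : ∀ {n} (i : Fin n) is c₁ c₂ cs → minor (i ∷ is) (c₁ ∷ c₂ ∷ cs) ≡
    scale (sgnQ 0) (var i c₁ *P minor is (c₂ ∷ cs)) +P
    (scale (sgnQ 1) (var i c₂ *P minor is (c₁ ∷ cs)) +P minorFrom i is (c₁ ∷ c₂ ∷ cs) 2 (c₁ ∷ c₂ ∷ []) cs)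
  minor-unfold {n} i is c₁ c₂ cs with List (Fin n) ∋ c₁ ∷ c₂ ∷ cs | 2 | List (Fin n) ∋ c₁ ∷ c₂ ∷ []
  ... | _ | _ | _ = ≡.refl

-- Minors as determinants

module _ {n : ℕ} where

  private
    R = polyRing n
  open CommutativeRing R using (_≈_; _+_; _*_; -_; refl; sym; trans; reflexive; setoid; +-cong; +-congˡ; *-congˡ; *-congʳ; -‿cong; *-identityˡ; ring)
  open RingP ring using (-‿distribˡ-*)
  open Determinant R
  open import Relation.Binary.Reasoning.Setoid setoid

  sgn-scale : ∀ k → sgn k ≈ scale (sgnQ k) oneP
  sgn-scale ℕ.zero = ≡⇒≃ ≡.refl
  sgn-scale (ℕ.suc k) = trans (-‿cong (sgn-scale k)) (coeffwise λ m → ≡.trans (coeff-neg (scale (sgnQ k) oneP) m)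
    (≡.trans (≡.cong -ℚ_ (coeff-scale (sgnQ k) oneP m))
      (≡.trans (ℚP.neg-distribˡ-* (sgnQ k) (coeff oneP m)) (≡.sym (coeff-scale (sgnQ (ℕ.suc k)) oneP m)))))

  scale-sgnQ : ∀ k p → scale (sgnQ k) p ≈ sgn k * p
  scale-sgnQ k p = sym (trans (*-congʳ (sgn-scale k))
    (≡⇒≃ (≡.trans (scale-*P (sgnQ k) oneP p) (≡.cong (scale (sgnQ k)) (*P-identityˡ p)))))

  -- The position counter `k` becomes a factor `sgn k`, since `alt` starts every list with a plus
  -- sign, and the accumulated prefix moves into the summand.
  minorFrom-alt : ∀ i is w k pre cs →
    minorFrom i is w k pre cs ≈ sgn k * alt (λ c cs′ → var i c *P minor is (pre ++ cs′)) cs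
  minorFrom-alt i is w k pre [] = ≡⇒≃ (≡.sym (*P-zeroʳ (sgn k)))
  minorFrom-alt i is w k pre (c ∷ cs) = begin
    scale (sgnQ k) (var i c *P minor is (pre ++ cs)) +P minorFrom i is w (ℕ.suc k) (pre ++ [ c ]) cs
      ≈⟨ +-cong (scale-sgnQ k _) (minorFrom-alt i is w (ℕ.suc k) (pre ++ [ c ]) cs) ⟩
    sgn k * (var i c *P minor is (pre ++ cs)) + - sgn k * alt (λ c′ cs′ → var i c′ *P minor is ((pre ++ [ c ]) ++ cs′)) cs
      ≈⟨ +-congˡ {sgn k * (var i c *P minor is (pre ++ cs))} (*-congˡ { - sgn k} (alt-cong
           (λ c′ cs′ → reflexive (≡.cong (λ z → var i c′ *P minor is z) (LP.++-assoc pre [ c ] cs′))) cs)) ⟩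
    sgn k * (var i c *P minor is (pre ++ cs)) + - sgn k * A
      ≈⟨ +-congˡ {sgn k * (var i c *P minor is (pre ++ cs))} (-‿distribˡ-* (sgn k) A) ⟨
    sgn k * (var i c *P minor is (pre ++ cs)) + - (sgn k * A)
      ≈⟨ x*[y-z]≈x*y-x*z (sgn k) _ A ⟨
    sgn k * ((var i c *P minor is (pre ++ cs)) + - A) ∎
    where A = alt (λ c′ cs′ → var i c′ *P minor is (pre ++ c ∷ cs′)) cs

  minor≈det : ∀ is cs → minor is cs ≈ det (map var is) cs
  minor≈det [] [] = refl
  minor≈det [] (_ ∷ _) = refl
  minor≈det (i ∷ is) cs = trans (minorFrom-alt i is cs 0 [] cs) (trans (*-identityˡ _)
    (alt-cong (λ c cs′ → *-congˡ {var i c} (minor≈det is cs′)) cs))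

-- Top-justified rows and sizes of blocks

take-allFin : ∀ {a} {B : Set a} {N n} (N≤n : N ≤ n) (h : Fin n → B) →
  tabulate (λ ρ → h (inject≤ ρ N≤n)) ≡ take N (tabulate h)
take-allFin {N = ℕ.zero} _ h = ≡.refl
take-allFin {N = ℕ.suc N} {ℕ.suc n} (s≤s N≤n) h = ≡.cong (h zero ∷_) (take-allFin N≤n (h ∘ suc))

take-top : ∀ {a} {B : Set a} r {N n} (r≤N : r ≤ N) (N≤n : N ≤ n) (h : Fin n → B) →
  map (λ ρ → h (inject≤ ρ N≤n)) (filterᵇ (λ ρ → toℕ ρ <ᵇ r) (allFin N)) ≡ take r (tabulate h)
take-top ℕ.zero {N} _ N≤n h = ≡.cong (map (λ ρ → h (inject≤ ρ N≤n))) (none (allFin N))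
  where
  none : ∀ xs → filterᵇ (λ ρ → toℕ ρ <ᵇ 0) xs ≡ []
  none [] = ≡.refl
  none (x ∷ xs) = none xs
take-top (ℕ.suc r) {ℕ.suc N} {ℕ.suc n} (s≤s r≤N) (s≤s N≤n) h = ≡.cong (h zero ∷_)
  (≡.trans (≡.cong (λ xs → map (λ ρ → h (inject≤ ρ (s≤s N≤n))) (filterᵇ (λ ρ → toℕ ρ <ᵇ ℕ.suc r) xs)) (tabulate≡map-allFin suc))
    (≡.trans (shift (allFin N)) (take-top r r≤N N≤n (h ∘ suc))))
  where
  shift : ∀ xs → map (λ ρ → h (inject≤ ρ (s≤s N≤n))) (filterᵇ (λ ρ → toℕ ρ <ᵇ ℕ.suc r) (map suc xs))
               ≡ map (λ ρ → h (suc (inject≤ ρ N≤n))) (filterᵇ (λ ρ → toℕ ρ <ᵇ r) xs)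
  shift [] = ≡.refl
  shift (x ∷ xs) with toℕ x <ᵇ r
  ... | true  = ≡.cong (h (suc (inject≤ x N≤n)) ∷_) (shift xs)
  ... | false = shift xs

∑ℕ-lower : ∀ d r (F : Fin d → ℕ) → (∀ j → r ≤ F j) → d ℕ.* r ≤ ∑ℕ F
∑ℕ-lower ℕ.zero r F r≤ = z≤n
∑ℕ-lower (ℕ.suc d) r F r≤ = ≡.subst (ℕ.suc d ℕ.* r ≤_) (≡.sym (∑ℕ-suc F))
  (ℕP.+-mono-≤ (r≤ zero) (∑ℕ-lower d r (F ∘ suc) (r≤ ∘ suc)))

-- The block sizes add up to `n` and each is at least `r`. This makes the truncated subtractions in
-- `nRows` and `shapeSize` genuine.
OP-size : ∀ {n d r} → OP n d r → d ℕ.* r ≤ n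
OP-size {n} {d} {r} π = ≡.subst (d ℕ.* r ≤_) total (∑ℕ-lower d r _ (OP.large π))
  where
  everything : ∀ {A : Set} (xs : List A) → countᵇ (λ _ → true) xs ≡ length xs
  everything xs = countᵇ-all (λ _ → true) (All.universal (λ _ → ≡.refl) xs)
  total : ∑ℕ (λ j → length (fiber (OP.block π) j)) ≡ n
  total = ≡.trans (∑ℕ-cong (λ j → ≡.sym (everything (fiber (OP.block π) j))))
    (≡.trans (≡.sym (countᵇ-by-colour (OP.block π) (λ _ → true) (allFin n)))
      (≡.trans (everything (allFin n)) (LP.length-tabulate id)))

-- The jellyfish invariant as a combination of generators

module Jellyfish {n d r : ℕ} (π : OP n (ℕ.suc d) r) where

  N : ℕ
  N = nRows n (ℕ.suc d) r

  N≤n : N ≤ n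
  N≤n = ℕP.m∸n≤m n (d ℕ.* r)

  size : r ℕ.+ d ℕ.* r ≤ n
  size = OP-size π

  r≤N : r ≤ N
  r≤N = ≡.subst (_≤ N) (ℕP.m+n∸n≡m r (d ℕ.* r)) (ℕP.∸-monoˡ-≤ (d ℕ.* r) size)

  private
    R = polyRing n
    ρs = allFin N
    f = OP.block π

  open CommutativeRing R using (_≈_; _*_; 0#; refl; sym; trans; reflexive; setoid; *-cong)
  open Determinant R
  open FinFold (CommutativeRing.*-commutativeMonoid R) using () renaming (fold to ∏; fold-cong to ∏-cong)
  open import Relation.Binary.Reasoning.Setoid setoid

  top : Fin N → Bool
  top ρ = toℕ ρ <ᵇ r

  row : Fin N → Fin n → Poly n
  row ρ = var (inject≤ ρ N≤n)

  open Mixed top row f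

  -- `shapeSize` subtracts one more `r` than `nRows` and adds it back, which under truncation
  -- requires `r≤N`.
  shapeSize-zero : shapeSize n (ℕ.suc d) r zero ≡ N
  shapeSize-zero = ≡.trans
    (≡.cong (λ z → n ∸ z ℕ.+ r) (≡.trans (ℕP.*-comm r (ℕ.suc d)) (ℕP.+-comm r (d ℕ.* r))))
    (≡.trans (≡.cong (ℕ._+ r) (≡.sym (ℕP.∸-+-assoc n (d ℕ.* r) r))) (ℕP.m∸n+n≡m r≤N))

  rows-justified : ∀ j → map (λ ρ → inject≤ ρ N≤n) (rowsOfColour j ρs) ≡ take (shapeSize n (ℕ.suc d) r j) (allFin n)
  rows-justified zero = ≡.trans (LP.map-tabulate id _)
    (≡.trans (take-allFin N≤n id) (≡.cong (λ k → take k (allFin n)) (≡.sym shapeSize-zero)))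
  rows-justified (suc j) = take-top r r≤N N≤n id

  shapeSize≤n : ∀ j → shapeSize n (ℕ.suc d) r j ≤ n
  shapeSize≤n zero = ≡.subst (_≤ n) (≡.sym shapeSize-zero) N≤n
  shapeSize≤n (suc j) = ℕP.≤-trans r≤N N≤n

  length-rowsOfColour : ∀ j → length (rowsOfColour j ρs) ≡ shapeSize n (ℕ.suc d) r j
  length-rowsOfColour j = ≡.trans (≡.sym (LP.length-map _ (rowsOfColour j ρs)))
    (≡.trans (≡.cong length (rows-justified j))
      (≡.trans (LP.length-take (shapeSize n (ℕ.suc d) r j) (allFin n))
        (ℕP.m≤n⇒m⊓n≡m (≡.subst (shapeSize n (ℕ.suc d) r j ≤_) (≡.sym (LP.length-tabulate id)) (shapeSize≤n j)))))

  good⇒shape : ∀ {v} → Good ρs v → Shape n (ℕ.suc d) r (V.lookup v)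
  good⇒shape (_ , sizes) j = ≡.trans (≡.sym (sizes j)) (length-rowsOfColour j)

  ∏-colourMinor : ∀ v → ∏ (colourMinor ρs v) ≈ flamingoGen n (ℕ.suc d) r (V.lookup v)
  ∏-colourMinor v = ∏-cong λ j → sym (trans (minor≈det (take (shapeSize n (ℕ.suc d) r j) (allFin n)) (fiber (V.lookup v) j))
    (reflexive (≡.cong (λ z → det z (fiber (V.lookup v) j))
      (≡.trans (≡.cong (map var) (≡.sym (rows-justified j))) (≡.sym (LP.map-∘ (rowsOfColour j ρs)))))))

  -- The column entries, the reading word and the row sets of `T` can all be read off from the list
  -- of its filled cells.
  jellyTerm-tableau : ∀ T → (if allᵇ (λ j → ⌊ LP.≡-dec Fin._≟_ (columnEntries {n} {ℕ.suc d} {r} T j) (fiber f j) ⌋) (allFin (ℕ.suc d))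
      then scale (sgnQ (inv (readingWord {n} {ℕ.suc d} {r} T))) (JT π T) else 0#)
    ≈ jellyTerm (allFin n) (flatten id T)
  jellyTerm-tableau T = begin
    (if allᵇ (λ j → matches′ (columnEntries {n} {ℕ.suc d} {r} T j) j) (allFin (ℕ.suc d))
      then scale (sgnQ (inv (readingWord {n} {ℕ.suc d} {r} T))) (JT π T) else 0#)
      ≡⟨ ≡.cong₂ (λ b w → if b then scale (sgnQ (inv w)) (JT π T) else 0#)
           (allᵇ-cong (λ j → ≡.cong (λ z → matches′ z j) (≡.sym (flatten-columnEntries id j T))) (allFin (ℕ.suc d)))
           (≡.sym (flatten-word id T)) ⟩
    (if allMatch e (allFin n) then scale (sgnQ (inv (map proj₂ e))) (JT π T) else 0#)
      ≈⟨ pull (allMatch e (allFin n)) ⟩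
    signedWord (allFin n) e * JT π T
      ≈⟨ *-cong (refl {signedWord (allFin n) e}) (∏-cong minors) ⟩
    jellyTerm (allFin n) e ∎
    where
    open Words {B = Fin N × Fin (ℕ.suc d)} proj₂ f
    open Coloured {A = Fin N × Fin (ℕ.suc d)} (row ∘ proj₁) proj₂ f using (block)
    e = flatten id T
    matches′ : List (Fin n) → Fin (ℕ.suc d) → Bool
    matches′ z j = ⌊ LP.≡-dec Fin._≟_ z (fiber f j) ⌋
    pull : ∀ b → (if b then scale (sgnQ (inv (map proj₂ e))) (JT π T) else 0#) ≈ (if b then sgn (inv (map proj₂ e)) else 0#) * JT π T
    pull true = scale-sgnQ (inv (map proj₂ e)) (JT π T)
    pull false = refl
    rows : ∀ j → map var (rowsOf {n} {ℕ.suc d} {r} T j) ≡ map (row ∘ proj₁) (ofColour proj₂ j (map proj₁ e))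
    rows j = ≡.trans (≡.sym (LP.map-∘ _)) (≡.trans (≡.cong (map row) (≡.trans (≡.sym (LP.map-id _)) (≡.sym (flatten-rows id j T))))
      (≡.trans (≡.sym (LP.map-∘ (ofColour column j e))) (≡.trans (LP.map-∘ (ofColour column j e)) (≡.cong (map (row ∘ proj₁)) (cells-of e)))))
      where
      cells-of : ∀ (es : List ((Fin N × Fin (ℕ.suc d)) × Fin n)) → map proj₁ (ofColour column j es) ≡ ofColour proj₂ j (map proj₁ es)
      cells-of [] = ≡.refl
      cells-of (((ρ , k) , c) ∷ es) with k Fin.≟ j
      ... | yes _ = ≡.cong ((ρ , k) ∷_) (cells-of es)
      ... | no _  = cells-of es
    minors : ∀ j → minor (rowsOf {n} {ℕ.suc d} {r} T j) (fiber f j) ≈ block (map proj₁ e) (allFin n) j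
    minors j = trans (minor≈det (rowsOf {n} {ℕ.suc d} {r} T j) (fiber f j)) (reflexive (≡.cong (λ z → det z (fiber f j)) (rows j)))

  jellyfish≈det : jellyfish π ≈ det (mixedRows ρs) (allFin n)
  jellyfish≈det = begin
    jellyfish π
      ≈⟨ Σ-filterᵇ (isJelly π) _ tableaux ⟩
    Σ (λ T → if isJelly π T then scale (sgnQ (inv (readingWord {n} {ℕ.suc d} {r} T))) (JT π T) else 0#) tableaux
      -- Of the two halves of `isJelly`, the row test stays outside for `tableauSum-det` and the
      -- column test is absorbed into `jellyTerm`.
      ≈⟨ Σ-cong (λ T → trans (if-∧ (rowsOk T) _ _) (if-cong (rowsOk T) (jellyTerm-tableau T))) tableaux ⟩
    Σ (λ T → if rowsOk T then jellyTerm (allFin n) (flatten id T) else 0#) tableaux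
      ≈⟨ tableauSum-det id (allFin n) (AllPairsP.tabulate⁺-< id) ⟩
    det (mixedRows ρs) (allFin n) ∎
    where
    tableaux = allVecs N (allVecs (ℕ.suc d) (cells n))
    rowsOk : Array n (ℕ.suc d) r → Bool
    rowsOk T = allᵇ (λ ρ → rowOk top (ℕ.suc d) n ρ (V.lookup T ρ)) (allFin N)

  colourings : List (Vec (Fin (ℕ.suc d)) n)
  colourings = filter (good? ρs) (allVecs n (allFin (ℕ.suc d)))

  combination : List (ℚ × (Fin n → Fin (ℕ.suc d)))
  combination = map (λ v → sgnQ (colouringSign ρs v) , V.lookup v) colourings

  combination-shapes : All (λ cg → Shape n (ℕ.suc d) r (proj₂ cg)) combination
  combination-shapes = AllP.map⁺ (All.map (λ {v} → good⇒shape {v}) (AllP.all-filter (good? ρs) (allVecs n (allFin (ℕ.suc d)))))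

  jellyfish≈combination : jellyfish π ≈ sumP (map (λ cg → scale (proj₁ cg) (flamingoGen n (ℕ.suc d) r (proj₂ cg))) combination)
  jellyfish≈combination = begin
    jellyfish π
      ≈⟨ jellyfish≈det ⟩
    det (mixedRows ρs) (allFin n)
      ≈⟨ det-mixedRows ρs ⟩
    Σ (λ v → sgn (colouringSign ρs v) * ∏ (colourMinor ρs v)) colourings
      ≈⟨ Σ-cong (λ v → trans (*-cong (refl {sgn (colouringSign ρs v)}) (∏-colourMinor v))
           (sym (scale-sgnQ (colouringSign ρs v) _))) colourings ⟩
    Σ (λ v → scale (sgnQ (colouringSign ρs v)) (flamingoGen n (ℕ.suc d) r (V.lookup v))) colourings
      ≈⟨ Σ-map (λ cg → scale (proj₁ cg) (flamingoGen n (ℕ.suc d) r (proj₂ cg))) _ colourings ⟨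
    Σ (λ cg → scale (proj₁ cg) (flamingoGen n (ℕ.suc d) r (proj₂ cg))) combination ∎

theorem4p15 : (n d r : ℕ) → 0 < n → 0 < d → 0 < r →
    (π : OP n d r) → InFlamingo n d r (jellyfish π)
theorem4p15 n (ℕ.suc d) r _ _ _ π = combination , combination-shapes , coeffs jellyfish≈combination
  where open Jellyfish π
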